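{- Assume $\gamma\le 1/2$. In the erasure model with parameter $\gamma$, any (possibly randomized) algorithm solving SELECT on $n$ elements with probability $2/3$, even one allowed $O(n/\gamma)$ comparisons per round, necessarily has round complexity $\Omega(\log^*(n))$.
   Context: Setting. The input is a set of $n$ elements with an unknown total order, presented in uniformly random order (the elements are a priori indistinguishable). SELECT (with $k=n/2$): output the median of the $n$ elements. Algorithms access the order only through pairwise comparison queries; the same pair may be queried several times (resampling). Round complexity is the number of adaptive rounds (within a round all queries are chosen before any answer of that round is seen). Erasure model with parameter $\gamma$: each comparison independently returns the correct answer with probability $\gamma$ and the symbol $\bot$ (erased) with probability $1-\gamma$. $\log^*$ is the iterated logarithm. Asymptotics are as $n\to\infty$. The success probability is over the random input order, the comparison outcomes and the algorithm's randomness. -}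

module Defs where

open import Algebra.Bundles using (CommutativeRing)
import Algebra.Definitions.RawMonoid as RawMonoidDefs
open import Data.Bool.Base using (Bool; if_then_else_)
open import Data.Fin.Base using (Fin; toℕ)
import Data.Fin.Properties as Fin
open import Data.List.Base as List using (List; allFin; cartesianProductWith; filter; foldr; length)
open import Data.Maybe.Base using (Maybe; just; nothing)
open import Data.Nat.Base as ℕ using (ℕ; zero; suc; _^_; ⌈_/2⌉; z≤n; s≤s)
open import Data.Nat.Induction using (Acc; acc; <-wellFounded)
open import Data.Nat.Logarithm using (⌈log₂_⌉; ⌈log₂⌉-mono-≤; ⌈log₂2^n⌉≡n)
import Data.Nat.Properties as ℕ
open import Data.Product.Base using (_×_)
open import Data.Vec.Base using (Vec; []; _∷_; lookup)
open import Data.Vec.Relation.Unary.AllPairs using (allPairs?)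
open import Data.Vec.Relation.Unary.Unique.Propositional using (Unique)
open import Level using (Level; _⊔_) renaming (suc to lsuc)
open import Relation.Binary.Core using (Rel)
open import Relation.Binary.PropositionalEquality.Core using (_≡_; _≢_; subst)
open import Relation.Binary.Structures using (IsTotalOrder)
open import Relation.Nullary.Decidable.Core using (Dec; ⌊_⌋; ¬?)
open import Relation.Nullary.Negation.Core using (¬_)
open import Relation.Unary using (Decidable)

-- Stands in for ℝ: probabilities take values in an arbitrary ordered field.
-- Division is total, with 0# ⁻¹ unspecified.
record OrderedField (c ℓ₁ ℓ₂ : Level) : Set (lsuc (c ⊔ ℓ₁ ⊔ ℓ₂)) where
  infix  4 _≤_ _<_
  infix  8 _⁻¹
  infixl 7 _/_
  field
    commutativeRing : CommutativeRing c ℓ₁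
  open CommutativeRing commutativeRing public
  field
    _⁻¹          : Carrier → Carrier
    _≤_          : Rel Carrier ℓ₂
    0≉1          : ¬ 0# ≈ 1#
    ⁻¹-inverseʳ  : ∀ x → ¬ x ≈ 0# → x * x ⁻¹ ≈ 1#
    isTotalOrder : IsTotalOrder _≈_ _≤_
    +-monoˡ-≤    : ∀ z {x y} → x ≤ y → x + z ≤ y + z
    *-nonNeg     : ∀ {x y} → 0# ≤ x → 0# ≤ y → 0# ≤ x * y

  _<_ : Rel Carrier (ℓ₁ ⊔ ℓ₂)
  x < y = x ≤ y × ¬ x ≈ y

  _/_ : Carrier → Carrier → Carrier
  x / y = x * y ⁻¹

  open RawMonoidDefs +-rawMonoid public using (sum) renaming (_×_ to _×ⁿ_)

  fromℕ : ℕ → Carrier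
  fromℕ k = k ×ⁿ 1#

n<2^n : ∀ n → n ℕ.< 2 ^ n
n<2^n zero    = s≤s z≤n
n<2^n (suc n) = ℕ.+-mono-≤ (ℕ.m^n>0 2 n) (ℕ.≤-trans (n<2^n n) (ℕ.m≤m+n (2 ^ n) 0))

⌈log₂1+n⌉<1+n : ∀ n → ⌈log₂ suc n ⌉ ℕ.< suc n
⌈log₂1+n⌉<1+n n = s≤s (subst (⌈log₂ suc n ⌉ ℕ.≤_) (⌈log₂2^n⌉≡n n) (⌈log₂⌉-mono-≤ (n<2^n n)))

log*-acc : ∀ n → Acc ℕ._<_ n → ℕ
log*-acc 0             _        = 0
log*-acc 1             _        = 0
log*-acc (suc (suc k)) (acc rs) = suc (log*-acc ⌈log₂ suc (suc k) ⌉ (rs (⌈log₂1+n⌉<1+n (suc k))))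

-- The least i such that the i-fold iterate of log₂ at n is at most 1.  Rounding
-- up at each step does not change it, as ⌈log₂ x⌉ = ⌈log₂ ⌈x⌉⌉ for x > 1.
log* : ℕ → ℕ
log* n = log*-acc n (<-wellFounded n)

-- A total order on the elements Fin n, given by the vector of their (0-based) ranks.
Ranking : ℕ → Set
Ranking n = Vec (Fin n) n

unique? : ∀ {n k} → Decidable (Unique {A = Fin n} {n = k})
unique? = allPairs? (λ i j → ¬? (i Fin.≟ j))

allVecs : ∀ n k → List (Vec (Fin n) k)
allVecs n zero    = [] List.∷ List.[]
allVecs n (suc k) = cartesianProductWith _∷_ (allFin n) (allVecs n k)

rankings : ∀ n → List (Ranking n)
rankings n = filter unique? (allVecs n n)

-- x is the k-th smallest element for k = ⌈n/2⌉: the median if n is odd, and the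
-- element of rank n/2 if n is even.
IsMedian : ∀ {n} → Ranking n → Fin n → Set
IsMedian {n} ρ x = suc (toℕ (lookup ρ x)) ≡ ⌈ n /2⌉

isMedian? : ∀ {n} (ρ : Ranking n) (x : Fin n) → Dec (IsMedian ρ x)
isMedian? {n} ρ x = suc (toℕ (lookup ρ x)) ℕ.≟ ⌈ n /2⌉

record Query (n : ℕ) : Set where
  constructor query
  field
    left right : Fin n
    .distinct  : left ≢ right

-- just b answers "left < right?"; nothing is the erasure symbol ⊥.
Answer : Set
Answer = Maybe Bool

compare : ∀ {n} → Ranking n → Query n → Bool
compare ρ q = ⌊ lookup ρ (Query.left q) Fin.<? lookup ρ (Query.right q) ⌋

-- Deterministic algorithms on n elements making at most m comparisons in each
-- round and using at most r rounds.  All the queries of a round are fixed before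
-- its answers are received; repetitions are allowed.
data Algorithm (n m : ℕ) : ℕ → Set where
  output : ∀ {r} → Fin n → Algorithm n m r
  round  : ∀ {r k} → k ℕ.≤ m → Vec (Query n) k →
           (Vec Answer k → Algorithm n m r) → Algorithm n m (suc r)

module _ {c ℓ₁ ℓ₂ : Level} (F : OrderedField c ℓ₁ ℓ₂) where
  open OrderedField F

  -- A distribution over deterministic algorithms.  For fixed n, m and r there are
  -- only finitely many of these, so finite supports lose no generality.
  record RandomizedAlgorithm (n m r : ℕ) : Set (c ⊔ ℓ₁ ⊔ ℓ₂) where
    field
      seeds         : ℕ
      weight        : Fin seeds → Carrier
      weight-nonNeg : ∀ s → 0# ≤ weight s
      weight-sum    : sum weight ≈ 1#
      run           : Fin seeds → Algorithm n m r

  -- Expectation of f over the answers to a batch of queries, each answer being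
  -- independently correct with probability γ and erased with probability 1 - γ.
  expectAnswers : ∀ {n k} → Carrier → Ranking n → Vec (Query n) k → (Vec Answer k → Carrier) → Carrier
  expectAnswers γ ρ []       f = f []
  expectAnswers γ ρ (q ∷ qs) f =
    γ        * expectAnswers γ ρ qs (λ as → f (just (compare ρ q) ∷ as)) +
    (1# - γ) * expectAnswers γ ρ qs (λ as → f (nothing ∷ as))

  successOn : ∀ {n m r} → Carrier → Ranking n → Algorithm n m r → Carrier
  successOn γ ρ (output x)       = if ⌊ isMedian? ρ x ⌋ then 1# else 0#
  successOn γ ρ (round _ qs next) = expectAnswers γ ρ qs (λ as → successOn γ ρ (next as))

  average : ∀ {a} {A : Set a} → List A → (A → Carrier) → Carrier
  average xs f = foldr (λ x s → f x + s) 0# xs / fromℕ (length xs)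

  successProbability : ∀ {n m r} → Carrier → RandomizedAlgorithm n m r → Carrier
  successProbability {n} γ A =
    sum (λ s → weight s * average (rankings n) (λ ρ → successOn γ ρ (run s)))
    where open RandomizedAlgorithm A

{-# OPTIONS --safe #-}

-- Call an element fresh as long as all its comparisons have been erased.
--
-- If a fresh element u exists at the end, then the answers do not depend on the
-- rank of u, and moving u to the other half of the order (keeping the order of
-- the remaining elements) changes which element is the median.  Hence the output
-- is correct with probability at most 1/2.
--
-- Suppose that there are Z ≥ n / T fresh elements before a round.  On average
-- such an element is in at most 2 C T / γ comparisons of the round, so it stays
-- fresh with probability 2 ^ - O (C T), and the expected number μ of fresh
-- elements after the round is at least 2 n / T′ with T′ = 2 ^ 2 ^ 2 ^ T.  One
-- comparison changes this number by at most 2, so by the Efron–Stein inequality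
-- its variance is at most 4 m γ ≤ 4 C n, and by Chebyshev's inequality at least
-- n / T′ fresh elements remain except with probability at most 4 C T′ ² / n.
-- So a fresh element is likely to survive until T reaches a power of n, which
-- takes Ω (log* n) rounds.
module Submission where

open import Defs
open import Level using (Level)
open import Data.Nat.Base as ℕ using (ℕ; zero; suc; z≤n; s≤s; ⌊_/2⌋; ⌈_/2⌉)
open import Data.Product.Base using (∃-syntax; _×_; _,_; proj₂)

open import Algebra.Bundles using (CommutativeRing)
import Algebra.Properties.Ring as RingProperties
import Algebra.Properties.Semiring.Exp as SemiringExp
import Algebra.Properties.Semiring.Mult as SemiringMult
import Algebra.Properties.Semiring.Sum as SemiringSum
import Algebra.Solver.Ring as RingSolver
open import Algebra.Solver.Ring.AlmostCommutativeRing using (fromCommutativeRing; _-Raw-AlmostCommutative⟶_)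
open import Data.Bool.Base using (Bool; true; false; if_then_else_; not; _∧_; _∨_)
import Data.Bool.Properties as Bool
open import Data.Empty using (⊥)
open import Data.Fin.Base as Fin using (Fin; zero; suc; toℕ; fromℕ<; opposite; punchIn; punchOut)
import Data.Fin.Permutation as Perm
open import Data.Fin.Permutation using (Permutation; _⟨$⟩ʳ_; _⟨$⟩ˡ_; _∘ₚ_)
import Data.Fin.Properties as Fin
open import Data.Integer.Base as ℤ using (ℤ; +_; -[1+_]; _⊖_)
import Data.Integer.Properties as ℤ
open import Data.List.Base as List using (List; []; _∷_; foldr; length)
open import Data.List.Membership.Propositional using (_∈_)
open import Data.List.Membership.Propositional.Properties using (∈-allFin; ∈-cartesianProductWith⁺; ∈-filter⁺; ∈-filter⁻; ∈-map⁺; ∈-map⁻)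
open import Data.List.Membership.Propositional.Properties.WithK using (unique∧set⇒bag)
open import Data.List.Relation.Binary.BagAndSetEquality using (∼bag⇒↭)
open import Data.List.Relation.Binary.Permutation.Propositional as Permutation using (_↭_)
open import Data.List.Relation.Unary.All using ([])
open import Data.List.Relation.Unary.AllPairs using ([]; _∷_)
open import Data.List.Relation.Unary.Any using (here; there)
import Data.List.Relation.Unary.Unique.Propositional as List
import Data.List.Relation.Unary.Unique.Propositional.Properties as List
open import Data.Maybe.Base using (just; nothing)
open import Data.Nat.Induction using (Acc; acc; <-wellFounded)
open import Data.Nat.Logarithm using (⌈log₂_⌉; ⌈log₂⌉-mono-≤; ⌈log₂2^n⌉≡n)
import Data.Nat.Properties as ℕ
open import Data.Nat.Solver using (module +-*-Solver)
open import Data.Sum.Base using (_⊎_; inj₁; inj₂)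
open import Data.Vec.Base as Vec using (Vec; []; _∷_; lookup)
import Data.Vec.Properties as Vec
open import Data.Vec.Relation.Unary.Unique.Propositional using (Unique)
import Data.Vec.Relation.Unary.Unique.Propositional.Properties as Unique
open import Function.Base using (_∘_)
open import Function.Bundles using (mk⇔)
open import Relation.Binary.Bundles using (Poset)
open import Relation.Binary.Definitions using (WeaklyDecidable)
open import Relation.Binary.PropositionalEquality as ≡ using (_≡_; _≢_)
import Relation.Binary.Reasoning.PartialOrder as PosetReasoning
open import Relation.Binary.Structures using (IsTotalOrder)
open import Relation.Nullary.Decidable using (Dec; yes; no; ⌊_⌋)
open import Relation.Nullary.Negation using (¬_; contradiction)

-- Ring solver over an abstract commutative ring

-- Coefficients in ℤ have decidable equality, so x - x is cancelled even though the ring is abstract.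
module IntegerSolver {c ℓ : Level} (R : CommutativeRing c ℓ) where
  open CommutativeRing R
  open RingProperties ring
  open SemiringMult semiring using (×-homo-+; ×1-homo-*) renaming (_×_ to _×ⁿ_)
  open import Relation.Binary.Reasoning.Setoid setoid

  ⟦_⟧ℤ : ℤ → Carrier
  ⟦ + n ⟧ℤ      = n ×ⁿ 1#
  ⟦ -[1+ n ] ⟧ℤ = - (suc n ×ⁿ 1#)

  x+y-[x+z]≈y-z : ∀ x y z → (x + y) - (x + z) ≈ y - z
  x+y-[x+z]≈y-z x y z = begin
    (x + y) - (x + z)       ≈⟨ +-congˡ (-‿+-comm x z) ⟨
    (x + y) + (- x - z)     ≈⟨ +-congʳ (+-comm x y) ⟩
    (y + x) + (- x - z)     ≈⟨ +-assoc y x _ ⟩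
    y + (x + (- x - z))     ≈⟨ +-congˡ (+-assoc x (- x) (- z)) ⟨
    y + ((x - x) - z)       ≈⟨ +-congˡ (+-congʳ (-‿inverseʳ x)) ⟩
    y + (0# - z)            ≈⟨ +-congˡ (+-identityˡ (- z)) ⟩
    y - z                   ∎

  ⊖-homo : ∀ m n → ⟦ m ⊖ n ⟧ℤ ≈ m ×ⁿ 1# - n ×ⁿ 1#
  ⊖-homo zero    zero    = sym (-‿inverseʳ 0#)
  ⊖-homo zero    (suc n) = sym (+-identityˡ _)
  ⊖-homo (suc m) zero    = sym (trans (+-congˡ -0#≈0#) (+-identityʳ _))
  ⊖-homo (suc m) (suc n) = begin
    ⟦ suc m ⊖ suc n ⟧ℤ            ≡⟨ ≡.cong ⟦_⟧ℤ (ℤ.[1+m]⊖[1+n]≡m⊖n m n) ⟩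
    ⟦ m ⊖ n ⟧ℤ                    ≈⟨ ⊖-homo m n ⟩
    m ×ⁿ 1# - n ×ⁿ 1#             ≈⟨ x+y-[x+z]≈y-z 1# _ _ ⟨
    suc m ×ⁿ 1# - suc n ×ⁿ 1#     ∎

  -‿homo : ∀ i → ⟦ ℤ.- i ⟧ℤ ≈ - ⟦ i ⟧ℤ
  -‿homo (+ zero)  = sym -0#≈0#
  -‿homo (+ suc n) = refl
  -‿homo -[1+ n ]  = sym (-‿involutive _)

  +-homo : ∀ i j → ⟦ i ℤ.+ j ⟧ℤ ≈ ⟦ i ⟧ℤ + ⟦ j ⟧ℤ
  +-homo (+ m)    (+ n)    = ×-homo-+ 1# m n
  +-homo (+ m)    -[1+ n ] = ⊖-homo m (suc n)
  +-homo -[1+ m ] (+ n)    = trans (⊖-homo n (suc m)) (+-comm _ _)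
  +-homo -[1+ m ] -[1+ n ] = begin
    - (suc (suc (m ℕ.+ n)) ×ⁿ 1#)      ≡⟨ ≡.cong (λ k → - (suc k ×ⁿ 1#)) (ℕ.+-suc m n) ⟨
    - ((suc m ℕ.+ suc n) ×ⁿ 1#)        ≈⟨ -‿cong (×-homo-+ 1# (suc m) (suc n)) ⟩
    - (suc m ×ⁿ 1# + suc n ×ⁿ 1#)      ≈⟨ -‿+-comm _ _ ⟨
    - (suc m ×ⁿ 1#) - suc n ×ⁿ 1#      ∎

  *-homo⁺ : ∀ m n → ⟦ + m ℤ.* + n ⟧ℤ ≈ m ×ⁿ 1# * n ×ⁿ 1#
  *-homo⁺ m n = trans (reflexive (≡.cong ⟦_⟧ℤ (≡.sym (ℤ.pos-* m n)))) (×1-homo-* m n)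

  *-homo : ∀ i j → ⟦ i ℤ.* j ⟧ℤ ≈ ⟦ i ⟧ℤ * ⟦ j ⟧ℤ
  *-homo (+ m)    (+ n)    = *-homo⁺ m n
  *-homo (+ m)    -[1+ n ] = begin
    ⟦ + m ℤ.* -[1+ n ] ⟧ℤ             ≡⟨ ≡.cong ⟦_⟧ℤ (ℤ.neg-distribʳ-* (+ m) (+ suc n)) ⟨
    ⟦ ℤ.- (+ m ℤ.* + suc n) ⟧ℤ        ≈⟨ -‿homo (+ m ℤ.* + suc n) ⟩
    - ⟦ + m ℤ.* + suc n ⟧ℤ            ≈⟨ -‿cong (*-homo⁺ m (suc n)) ⟩
    - (m ×ⁿ 1# * suc n ×ⁿ 1#)         ≈⟨ -‿distribʳ-* _ _ ⟩
    m ×ⁿ 1# * - (suc n ×ⁿ 1#)         ∎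
  *-homo -[1+ m ] (+ n)    = begin
    ⟦ -[1+ m ] ℤ.* + n ⟧ℤ             ≡⟨ ≡.cong ⟦_⟧ℤ (ℤ.neg-distribˡ-* (+ suc m) (+ n)) ⟨
    ⟦ ℤ.- (+ suc m ℤ.* + n) ⟧ℤ        ≈⟨ -‿homo (+ suc m ℤ.* + n) ⟩
    - ⟦ + suc m ℤ.* + n ⟧ℤ            ≈⟨ -‿cong (*-homo⁺ (suc m) n) ⟩
    - (suc m ×ⁿ 1# * n ×ⁿ 1#)         ≈⟨ -‿distribˡ-* _ _ ⟩
    - (suc m ×ⁿ 1#) * n ×ⁿ 1#         ∎
  *-homo -[1+ m ] -[1+ n ] = begin
    (suc m ℕ.* suc n) ×ⁿ 1#             ≈⟨ ×1-homo-* (suc m) (suc n) ⟩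
    suc m ×ⁿ 1# * suc n ×ⁿ 1#           ≈⟨ -‿involutive _ ⟨
    - - (suc m ×ⁿ 1# * suc n ×ⁿ 1#)     ≈⟨ -‿cong (-‿distribˡ-* _ _) ⟩
    - (- (suc m ×ⁿ 1#) * suc n ×ⁿ 1#)   ≈⟨ -‿distribʳ-* _ _ ⟩
    - (suc m ×ⁿ 1#) * - (suc n ×ⁿ 1#)   ∎

  homomorphism : ℤ.+-*-rawRing -Raw-AlmostCommutative⟶ fromCommutativeRing R
  homomorphism = record
    { ⟦_⟧    = ⟦_⟧ℤ
    ; +-homo = +-homo
    ; *-homo = *-homo
    ; -‿homo = -‿homo
    ; 0-homo = refl
    ; 1-homo = +-identityʳ 1#
    }

  _coeff≟_ : WeaklyDecidable (λ i j → ⟦ i ⟧ℤ ≈ ⟦ j ⟧ℤ)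
  i coeff≟ j with i ℤ.≟ j
  ... | yes i≡j = just (reflexive (≡.cong ⟦_⟧ℤ i≡j))
  ... | no  _   = nothing

  open RingSolver ℤ.+-*-rawRing (fromCommutativeRing R) homomorphism _coeff≟_ public
    using (Polynomial; solve; _:+_; _:*_; _:-_; _:^_; _:=_; con)

  -- con (+ 1) denotes 1# + 0#, whereas this denotes 1# on the nose.
  :1 : ∀ {n} → Polynomial n
  :1 = con (+ 0) :^ 0

-- Arithmetic and finite sums in an ordered field

module OrderedFieldProperties {c ℓ₁ ℓ₂ : Level} (F : OrderedField c ℓ₁ ℓ₂) where
  open OrderedField F public hiding (zero) renaming (trans to ≈-trans; sym to ≈-sym; refl to ≈-refl; reflexive to ≈-reflexive)
  open IsTotalOrder isTotalOrder public
    using (total; antisym) renaming (trans to ≤-trans; refl to ≤-refl; reflexive to ≤-reflexive)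
  open IntegerSolver commutativeRing public using (solve; _:+_; _:*_; _:-_; _:=_; con; :1)
  open SemiringMult semiring public using (×-homo-+; ×1-homo-*)
  open SemiringSum semiring public using (sum-cong-≋; ∑-distrib-+; *-distribˡ-sum; *-distribʳ-sum; sum-replicate-zero; sum-replicate)

  poset : Poset c ℓ₁ ℓ₂
  poset = record { isPartialOrder = IsTotalOrder.isPartialOrder isTotalOrder }

  module ≤-Reasoning = PosetReasoning poset

  +-mono-≤ : ∀ {w x y z} → w ≤ x → y ≤ z → w + y ≤ x + z
  +-mono-≤ {w} {x} {y} {z} w≤x y≤z = begin
    w + y  ≤⟨ +-monoˡ-≤ y w≤x ⟩
    x + y  ≈⟨ +-comm x y ⟩
    y + x  ≤⟨ +-monoˡ-≤ x y≤z ⟩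
    z + x  ≈⟨ +-comm z x ⟩
    x + z  ∎
    where open ≤-Reasoning

  -- For linear arithmetic: a ≤ b combines the hypotheses, and the equation is left to the ring solver.
  ≤-by : ∀ {a b x y} → a ≤ b → y + a ≈ x + b → x ≤ y
  ≤-by {a} {b} {x} {y} a≤b eq = begin
    x              ≈⟨ solve 2 (λ x b → x := (x :+ b) :- b) ≈-refl x b ⟩
    (x + b) - b    ≈⟨ +-congʳ eq ⟨
    (y + a) - b    ≈⟨ solve 3 (λ y a b → (y :+ a) :- b := a :+ (y :- b)) ≈-refl y a b ⟩
    a + (y - b)    ≤⟨ +-monoˡ-≤ (y - b) a≤b ⟩
    b + (y - b)    ≈⟨ solve 2 (λ y b → b :+ (y :- b) := y) ≈-refl y b ⟩
    y              ∎
    where open ≤-Reasoning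

  ≤-by′ : ∀ {a x y} → 0# ≤ a → y ≈ x + a → x ≤ y
  ≤-by′ 0≤a eq = ≤-by 0≤a (≈-trans (+-identityʳ _) eq)

  ≤⇒0≤- : ∀ {x y} → x ≤ y → 0# ≤ y - x
  ≤⇒0≤- {x} {y} x≤y = ≤-by x≤y (solve 2 (λ x y → (y :- x) :+ x := con (+ 0) :+ y) ≈-refl x y)

  *-monoˡ-≤ : ∀ {z x y} → 0# ≤ z → x ≤ y → z * x ≤ z * y
  *-monoˡ-≤ {z} {x} {y} 0≤z x≤y = ≤-by′ (*-nonNeg 0≤z (≤⇒0≤- x≤y))
    (solve 3 (λ z x y → z :* y := z :* x :+ z :* (y :- x)) ≈-refl z x y)

  *-monoʳ-≤ : ∀ {z x y} → 0# ≤ z → x ≤ y → x * z ≤ y * z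
  *-monoʳ-≤ {z} {x} {y} 0≤z x≤y = begin
    x * z  ≈⟨ *-comm x z ⟩
    z * x  ≤⟨ *-monoˡ-≤ 0≤z x≤y ⟩
    z * y  ≈⟨ *-comm z y ⟩
    y * z  ∎
    where open ≤-Reasoning

  *-mono-≤ : ∀ {w x y z} → 0# ≤ w → 0# ≤ z → w ≤ x → y ≤ z → w * y ≤ x * z
  *-mono-≤ 0≤w 0≤z w≤x y≤z = ≤-trans (*-monoˡ-≤ 0≤w y≤z) (*-monoʳ-≤ 0≤z w≤x)

  x²-nonNeg : ∀ x → 0# ≤ x * x
  x²-nonNeg x with total 0# x
  ... | inj₁ 0≤x = *-nonNeg 0≤x 0≤x
  ... | inj₂ x≤0 = ≤-trans (*-nonNeg (≤⇒0≤- x≤0) (≤⇒0≤- x≤0))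
        (≤-reflexive (solve 1 (λ x → (con (+ 0) :- x) :* (con (+ 0) :- x) := x :* x) ≈-refl x))

  0≤1 : 0# ≤ 1#
  0≤1 = ≤-trans (x²-nonNeg 1#) (≤-reflexive (*-identityˡ 1#))

  1≰0 : ¬ 1# ≤ 0#
  1≰0 1≤0 = 0≉1 (antisym 0≤1 1≤0)

  fromℕ-nonNeg : ∀ k → 0# ≤ fromℕ k
  fromℕ-nonNeg zero    = ≤-refl
  fromℕ-nonNeg (suc k) = ≤-trans (≤-reflexive (≈-sym (+-identityˡ 0#))) (+-mono-≤ 0≤1 (fromℕ-nonNeg k))

  fromℕ-mono-≤ : ∀ {j k} → j ℕ.≤ k → fromℕ j ≤ fromℕ k
  fromℕ-mono-≤ {k = k} z≤n = fromℕ-nonNeg k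
  fromℕ-mono-≤ (s≤s j≤k)   = +-mono-≤ ≤-refl (fromℕ-mono-≤ j≤k)

  fromℕ-+ : ∀ j k → fromℕ (j ℕ.+ k) ≈ fromℕ j + fromℕ k
  fromℕ-+ = ×-homo-+ 1#

  fromℕ-* : ∀ j k → fromℕ (j ℕ.* k) ≈ fromℕ j * fromℕ k
  fromℕ-* = ×1-homo-*

  1+k≰0 : ∀ k → ¬ fromℕ (suc k) ≤ 0#
  1+k≰0 k 1+k≤0 = 1≰0 (≤-trans (≤-by′ (fromℕ-nonNeg k) ≈-refl) 1+k≤0)

  Positive : Carrier → Set _
  Positive x = 0# ≤ x × ¬ x ≈ 0#

  fromℕ-positive : ∀ {k} → 1 ℕ.≤ k → Positive (fromℕ k)
  fromℕ-positive {suc k} _ = fromℕ-nonNeg (suc k) , λ eq → 1+k≰0 k (≤-reflexive eq)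

  ⁻¹-inverseˡ : ∀ {x} → ¬ x ≈ 0# → x ⁻¹ * x ≈ 1#
  ⁻¹-inverseˡ x≉0 = ≈-trans (*-comm _ _) (⁻¹-inverseʳ _ x≉0)

  /-cancelʳ : ∀ x {y} → ¬ y ≈ 0# → (x / y) * y ≈ x
  /-cancelʳ x {y} y≉0 = ≈-trans (*-assoc x (y ⁻¹) y) (≈-trans (*-congˡ (⁻¹-inverseˡ y≉0)) (*-identityʳ x))

  -- Totality replaces any information on the sign of `z ⁻¹`: in the case `y ≤ x` the two products
  -- agree by antisymmetry, and multiplying by `z ⁻¹` identifies `x` with `y`.
  *-cancelˡ-≤ : ∀ {z x y} → Positive z → z * x ≤ z * y → x ≤ y
  *-cancelˡ-≤ {z} {x} {y} (0≤z , z≉0) zx≤zy with total x y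
  ... | inj₁ x≤y = x≤y
  ... | inj₂ y≤x = ≤-reflexive (begin
        x                ≈⟨ unscale x ⟨
        z ⁻¹ * (z * x)   ≈⟨ *-congˡ (antisym zx≤zy (*-monoˡ-≤ 0≤z y≤x)) ⟩
        z ⁻¹ * (z * y)   ≈⟨ unscale y ⟩
        y                ∎)
    where
    open import Relation.Binary.Reasoning.Setoid setoid
    unscale : ∀ w → z ⁻¹ * (z * w) ≈ w
    unscale w = ≈-trans (≈-sym (*-assoc _ _ w)) (≈-trans (*-congʳ (⁻¹-inverseˡ z≉0)) (*-identityˡ w))

  sum-mono-≤ : ∀ {n} {f g : Fin n → Carrier} → (∀ i → f i ≤ g i) → sum f ≤ sum g
  sum-mono-≤ {zero}  f≤g = ≤-refl
  sum-mono-≤ {suc n} f≤g = +-mono-≤ (f≤g zero) (sum-mono-≤ (f≤g ∘ suc))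

  ind : Bool → Carrier
  ind b = if b then 1# else 0#

  ind-nonNeg : ∀ b → 0# ≤ ind b
  ind-nonNeg true  = 0≤1
  ind-nonNeg false = ≤-refl

  ind≤1 : ∀ b → ind b ≤ 1#
  ind≤1 true  = ≤-refl
  ind≤1 false = 0≤1

  sum-ind-≟ : ∀ {n} (j : Fin n) → sum (λ i → ind ⌊ i Fin.≟ j ⌋) ≈ 1#
  sum-ind-≟ {suc n} zero    = ≈-trans (+-congˡ (sum-replicate-zero n)) (+-identityʳ 1#)
  sum-ind-≟ {suc n} (suc j) = ≈-trans (+-identityˡ _)
    (≈-trans (sum-cong-≋ (λ i → ≈-reflexive (≡.cong ind (suc-≟ i)))) (sum-ind-≟ j))
    where
    suc-≟ : ∀ i → ⌊ Fin.suc i Fin.≟ suc j ⌋ ≡ ⌊ i Fin.≟ j ⌋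
    suc-≟ i with i Fin.≟ j
    ... | yes _ = ≡.refl
    ... | no  _ = ≡.refl

-- Sums over lists

module ListSum {c ℓ₁ ℓ₂ : Level} (F : OrderedField c ℓ₁ ℓ₂) where
  open OrderedFieldProperties F

  module _ {a : Level} {A : Set a} where
    listSum : List A → (A → Carrier) → Carrier
    listSum xs f = foldr (λ x s → f x + s) 0# xs

    listSum-mono : ∀ xs {f g} → (∀ {x} → x ∈ xs → f x ≤ g x) → listSum xs f ≤ listSum xs g
    listSum-mono []       f≤g = ≤-refl
    listSum-mono (x ∷ xs) f≤g = +-mono-≤ (f≤g (here ≡.refl)) (listSum-mono xs (f≤g ∘ there))

    listSum-+ : ∀ xs f g → listSum xs (λ x → f x + g x) ≈ listSum xs f + listSum xs g
    listSum-+ []       f g = ≈-sym (+-identityˡ 0#)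
    listSum-+ (x ∷ xs) f g = ≈-trans (+-congˡ (listSum-+ xs f g))
      (solve 4 (λ a b x y → (a :+ b) :+ (x :+ y) := (a :+ x) :+ (b :+ y)) ≈-refl _ _ _ _)

    listSum-* : ∀ xs y f → listSum xs (λ x → y * f x) ≈ y * listSum xs f
    listSum-* []       y f = ≈-sym (zeroʳ y)
    listSum-* (x ∷ xs) y f = ≈-trans (+-congˡ (listSum-* xs y f)) (≈-sym (distribˡ y _ _))

    listSum-1 : ∀ xs → listSum xs (λ _ → 1#) ≈ fromℕ (length xs)
    listSum-1 []       = ≈-refl
    listSum-1 (x ∷ xs) = +-congˡ (listSum-1 xs)

    listSum-sum : ∀ xs k (f : Fin k → A → Carrier) →
                  listSum xs (λ x → sum (λ i → f i x)) ≈ sum (λ i → listSum xs (f i))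
    listSum-sum []       k f = ≈-sym (sum-replicate-zero k)
    listSum-sum (x ∷ xs) k f = ≈-trans (+-congˡ (listSum-sum xs k f)) (≈-sym (∑-distrib-+ {k} (λ i → f i x) _))

    listSum-map : ∀ (g : A → A) xs f → listSum (List.map g xs) f ≡ listSum xs (f ∘ g)
    listSum-map g []       f = ≡.refl
    listSum-map g (x ∷ xs) f = ≡.cong (λ s → f (g x) + s) (listSum-map g xs f)

    listSum-↭ : ∀ {xs ys} → xs ↭ ys → ∀ f → listSum xs f ≈ listSum ys f
    listSum-↭ Permutation.refl           f = ≈-refl
    listSum-↭ (Permutation.prep x p)     f = +-congˡ (listSum-↭ p f)
    listSum-↭ (Permutation.swap x y p)   f = ≈-trans (+-congˡ (+-congˡ (listSum-↭ p f)))
      (solve 3 (λ a b s → a :+ (b :+ s) := b :+ (a :+ s)) ≈-refl (f x) (f y) _)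
    listSum-↭ (Permutation.trans p₁ p₂)  f = ≈-trans (listSum-↭ p₁ f) (listSum-↭ p₂ f)

-- Growth of towers and the iterated logarithm

-- The two accessibility proofs are arbitrary, because unfolding `log*` by one step leaves a proof
-- other than the one `<-wellFounded` gives.
log*-acc-mono : ∀ {m n} (p : Acc ℕ._<_ m) (q : Acc ℕ._<_ n) → m ℕ.≤ n → log*-acc m p ℕ.≤ log*-acc n q
log*-acc-mono {0}           p        q        m≤n = z≤n
log*-acc-mono {1}           p        q        m≤n = z≤n
log*-acc-mono {suc (suc m)} {suc (suc n)} (acc p) (acc q) m≤n =
  s≤s (log*-acc-mono (p _) (q _) (⌈log₂⌉-mono-≤ m≤n))
log*-acc-mono {suc (suc m)} {1} p q (s≤s ())

log*-mono : ∀ {m n} → m ℕ.≤ n → log* m ℕ.≤ log* n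
log*-mono {m} {n} = log*-acc-mono (<-wellFounded m) (<-wellFounded n)

log*2^n≤1+log*n : ∀ n → log* (2 ℕ.^ n) ℕ.≤ suc (log* n)
log*2^n≤1+log*n n = go (2 ℕ.^ n) (<-wellFounded _) (ℕ.≤-reflexive (⌈log₂2^n⌉≡n n))
  where
  go : ∀ m (p : Acc ℕ._<_ m) → ⌈log₂ m ⌉ ℕ.≤ n → log*-acc m p ℕ.≤ suc (log* n)
  go 0             p       _  = z≤n
  go 1             p       _  = z≤n
  go (suc (suc m)) (acc p) le = s≤s (log*-acc-mono (p _) (<-wellFounded n) le)

exp₃ : ℕ → ℕ
exp₃ T = 2 ℕ.^ (2 ℕ.^ (2 ℕ.^ T))

tower : ℕ → ℕ → ℕ
tower zero    T = T
tower (suc r) T = tower r (exp₃ T)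

-- One step of `tower` applies three exponentials, and each raises `log*` by at most one. This turns
-- a lower bound on the tower height into one on the number of rounds.
log*-tower : ∀ r T → log* (tower r T) ℕ.≤ r ℕ.* 3 ℕ.+ log* T
log*-tower zero    T = ℕ.≤-refl
log*-tower (suc r) T = begin
  log* (tower r (exp₃ T))            ≤⟨ log*-tower r _ ⟩
  r ℕ.* 3 ℕ.+ log* (exp₃ T)          ≤⟨ ℕ.+-monoʳ-≤ (r ℕ.* 3) log*-exp₃ ⟩
  r ℕ.* 3 ℕ.+ (3 ℕ.+ log* T)         ≡⟨ ℕ.+-assoc (r ℕ.* 3) 3 _ ⟨
  r ℕ.* 3 ℕ.+ 3 ℕ.+ log* T           ≡⟨ ≡.cong (ℕ._+ log* T) (ℕ.+-comm (r ℕ.* 3) 3) ⟩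
  suc r ℕ.* 3 ℕ.+ log* T             ∎
  where
  open ℕ.≤-Reasoning
  log*-exp₃ : log* (exp₃ T) ℕ.≤ 3 ℕ.+ log* T
  log*-exp₃ = ℕ.≤-trans (log*2^n≤1+log*n (2 ℕ.^ (2 ℕ.^ T)))
    (s≤s (ℕ.≤-trans (log*2^n≤1+log*n (2 ℕ.^ T)) (s≤s (log*2^n≤1+log*n T))))

n≤2^n : ∀ n → n ℕ.≤ 2 ℕ.^ n
n≤2^n n = ℕ.<⇒≤ (n<2^n n)

T≤exp₃T : ∀ T → T ℕ.≤ exp₃ T
T≤exp₃T T = ℕ.≤-trans (n≤2^n T) (ℕ.≤-trans (n≤2^n _) (n≤2^n _))

4*n≤2^n : ∀ {n} → 4 ℕ.≤ n → 4 ℕ.* n ℕ.≤ 2 ℕ.^ n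
4*n≤2^n {n} 4≤n with ℕ.m≤n⇒∃[o]m+o≡n 4≤n
... | k , ≡.refl = begin
  4 ℕ.* (4 ℕ.+ k)       ≤⟨ ℕ.*-monoʳ-≤ 4 (ℕ.+-monoʳ-≤ 4 (ℕ.m≤n*m k 4)) ⟩
  4 ℕ.* (4 ℕ.+ 4 ℕ.* k) ≡⟨ solve 1 (λ k → con 4 :* (con 4 :+ con 4 :* k) := con 16 :* (con 1 :+ k)) ≡.refl k ⟩
  16 ℕ.* suc k          ≤⟨ ℕ.*-monoʳ-≤ 16 (n<2^n k) ⟩
  16 ℕ.* 2 ℕ.^ k        ≡⟨ ℕ.^-distribˡ-+-* 2 4 k ⟨
  2 ℕ.^ (4 ℕ.+ k)       ∎
  where
  open ℕ.≤-Reasoning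
  open +-*-Solver

n^4≤2^2^n : ∀ {n} → 4 ℕ.≤ n → n ℕ.^ 4 ℕ.≤ 2 ℕ.^ (2 ℕ.^ n)
n^4≤2^2^n {n} 4≤n = begin
  n ℕ.^ 4             ≤⟨ ℕ.^-monoˡ-≤ 4 (n≤2^n n) ⟩
  (2 ℕ.^ n) ℕ.^ 4     ≡⟨ ℕ.^-*-assoc 2 n 4 ⟩
  2 ℕ.^ (n ℕ.* 4)     ≡⟨ ≡.cong (2 ℕ.^_) (ℕ.*-comm n 4) ⟩
  2 ℕ.^ (4 ℕ.* n)     ≤⟨ ℕ.^-monoʳ-≤ 2 (4*n≤2^n 4≤n) ⟩
  2 ℕ.^ (2 ℕ.^ n)     ∎
  where open ℕ.≤-Reasoning

-- An element in at most 4 C T / γ comparisons of a round, twice the average, stays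
-- fresh with probability at least 1 / shrinkage C T.
shrinkage : ℕ → ℕ → ℕ
shrinkage C T = 4 ℕ.* 4 ℕ.^ (4 ℕ.* (4 ℕ.* (C ℕ.* T)))

-- As `C ≤ T`, the binary logarithm of the left side is at most quadratic in `T`, whereas that of
-- `exp₃ T` is doubly exponential. The factor 4 pays for two losses of a factor 2: one from
-- averaging over the elements, one to keep the mean away from the threshold in Chebyshev's
-- inequality.
shrinkage-≤ : ∀ {C T} → C ℕ.≤ T → 48 ℕ.≤ T → 4 ℕ.* (shrinkage C T ℕ.* T) ℕ.≤ exp₃ T
shrinkage-≤ {C} {T} C≤T 48≤T = begin
  4 ℕ.* (4 ℕ.* 4 ℕ.^ x ℕ.* T)                      ≤⟨ ℕ.*-monoʳ-≤ 4 (ℕ.*-monoʳ-≤ (4 ℕ.* 4 ℕ.^ x) (n≤2^n T)) ⟩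
  4 ℕ.* (4 ℕ.* 4 ℕ.^ x ℕ.* 2 ℕ.^ T)                ≡⟨ ≡.cong (λ y → 4 ℕ.* (4 ℕ.* y ℕ.* 2 ℕ.^ T)) (ℕ.^-*-assoc 2 2 x) ⟩
  4 ℕ.* (4 ℕ.* 2 ℕ.^ (2 ℕ.* x) ℕ.* 2 ℕ.^ T)        ≡⟨ solve 2 (λ y z → con 4 :* (con 4 :* y :* z) := con 16 :* (y :* z)) ≡.refl (2 ℕ.^ (2 ℕ.* x)) (2 ℕ.^ T) ⟩
  16 ℕ.* (2 ℕ.^ (2 ℕ.* x) ℕ.* 2 ℕ.^ T)             ≡⟨ ≡.cong (16 ℕ.*_) (ℕ.^-distribˡ-+-* 2 (2 ℕ.* x) T) ⟨
  16 ℕ.* 2 ℕ.^ (2 ℕ.* x ℕ.+ T)                     ≡⟨ ℕ.^-distribˡ-+-* 2 4 (2 ℕ.* x ℕ.+ T) ⟨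
  2 ℕ.^ (4 ℕ.+ (2 ℕ.* x ℕ.+ T))                    ≤⟨ ℕ.^-monoʳ-≤ 2 (ℕ.≤-trans exponent (n^4≤2^2^n 4≤T)) ⟩
  exp₃ T                                           ∎
  where
  open ℕ.≤-Reasoning
  open +-*-Solver
  x = 4 ℕ.* (4 ℕ.* (C ℕ.* T))
  1≤T : 1 ℕ.≤ T
  1≤T = ℕ.≤-trans (s≤s z≤n) 48≤T
  4≤T : 4 ℕ.≤ T
  4≤T = ℕ.≤-trans (ℕ.m≤m+n 4 44) 48≤T
  -- The constant 48 is chosen to exceed the 37 that arises here, and for the `48 ℕ.* C` in
  -- `budget-≤`.
  exponent : 4 ℕ.+ (2 ℕ.* x ℕ.+ T) ℕ.≤ T ℕ.^ 4
  exponent = begin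
    4 ℕ.+ (2 ℕ.* x ℕ.+ T)
      ≤⟨ ℕ.+-mono-≤ (ℕ.*-monoʳ-≤ 4 (ℕ.*-mono-≤ 1≤T 1≤T)) (ℕ.+-mono-≤ (ℕ.*-monoʳ-≤ 2 (ℕ.*-monoʳ-≤ 4 (ℕ.*-monoʳ-≤ 4 (ℕ.*-monoˡ-≤ T C≤T)))) (ℕ.m≤m*n T T {{ℕ.>-nonZero 1≤T}})) ⟩
    4 ℕ.* (T ℕ.* T) ℕ.+ (2 ℕ.* (4 ℕ.* (4 ℕ.* (T ℕ.* T))) ℕ.+ T ℕ.* T)
      ≡⟨ solve 1 (λ y → con 4 :* y :+ (con 2 :* (con 4 :* (con 4 :* y)) :+ y) := con 37 :* y) ≡.refl (T ℕ.* T) ⟩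
    37 ℕ.* (T ℕ.* T)
      ≤⟨ ℕ.*-monoˡ-≤ (T ℕ.* T) (ℕ.≤-trans (ℕ.m≤m+n 37 11) 48≤T) ⟩
    T ℕ.* (T ℕ.* T)
      ≤⟨ ℕ.*-monoʳ-≤ T (ℕ.*-monoʳ-≤ T (ℕ.m≤m*n T (T ℕ.* 1) {{ℕ.>-nonZero (ℕ.*-mono-≤ 1≤T (ℕ.≤-refl {1}))}})) ⟩
    T ℕ.^ 4 ∎

-- A bound on `n` times the probability that no fresh element is left after `r` rounds that start
-- with at least `n / T` of them. Each round adds the numerator of its Chebyshev bound, taken at the
-- threshold valid after the round.
budget : ℕ → ℕ → ℕ → ℕ
budget C zero    T = 0
budget C (suc r) T = budget C r (exp₃ T) ℕ.+ 4 ℕ.* C ℕ.* (exp₃ T ℕ.* exp₃ T)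

-- The summand `T ℕ.^ 4` strengthens the induction: together with the contribution of one round it
-- is absorbed by the fourth power of the next threshold. The factor 12 makes the total failure
-- probability at most 1/12.
budget-≤ : ∀ C r T → C ℕ.≤ T → 48 ℕ.≤ T → 12 ℕ.* budget C r T ℕ.+ T ℕ.^ 4 ℕ.≤ tower (suc r) T
budget-≤ C zero    T C≤T 48≤T = ℕ.≤-trans (n^4≤2^2^n (ℕ.≤-trans (ℕ.m≤m+n 4 44) 48≤T)) (n≤2^n _)
budget-≤ C (suc r) T C≤T 48≤T = begin
  12 ℕ.* (b ℕ.+ 4 ℕ.* C ℕ.* (T′ ℕ.* T′)) ℕ.+ T ℕ.^ 4
    ≡⟨ solve 4 (λ b c t s → con 12 :* (b :+ con 4 :* c :* t) :+ s := con 12 :* b :+ (con 48 :* c :* t :+ s)) ≡.refl b C (T′ ℕ.* T′) (T ℕ.^ 4) ⟩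
  12 ℕ.* b ℕ.+ (48 ℕ.* C ℕ.* (T′ ℕ.* T′) ℕ.+ T ℕ.^ 4)
    ≤⟨ ℕ.+-monoʳ-≤ (12 ℕ.* b) step ⟩
  12 ℕ.* b ℕ.+ T′ ℕ.^ 4
    ≤⟨ budget-≤ C r T′ (ℕ.≤-trans C≤T (T≤exp₃T T)) 48≤T′ ⟩
  tower (suc r) T′ ∎
  where
  open ℕ.≤-Reasoning
  open +-*-Solver
  T′ = exp₃ T
  b  = budget C r T′
  48≤T′ : 48 ℕ.≤ T′
  48≤T′ = ℕ.≤-trans 48≤T (T≤exp₃T T)
  1≤T : 1 ℕ.≤ T
  1≤T = ℕ.≤-trans (s≤s z≤n) 48≤T
  1≤T′ : 1 ℕ.≤ T′
  1≤T′ = ℕ.≤-trans (s≤s z≤n) 48≤T′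
  T^4≤T′ : T ℕ.^ 4 ℕ.≤ T′
  T^4≤T′ = ℕ.≤-trans (n^4≤2^2^n (ℕ.≤-trans (ℕ.m≤m+n 4 44) 48≤T)) (n≤2^n _)
  48C≤T′ : 48 ℕ.* C ℕ.≤ T′
  48C≤T′ = begin
    48 ℕ.* C   ≤⟨ ℕ.*-mono-≤ 48≤T C≤T ⟩
    T ℕ.* T    ≤⟨ ℕ.*-monoʳ-≤ T (ℕ.m≤m*n T (T ℕ.^ 2) {{ℕ.>-nonZero (ℕ.*-mono-≤ 1≤T (ℕ.*-mono-≤ 1≤T (ℕ.≤-refl {1})))}}) ⟩
    T ℕ.^ 4    ≤⟨ T^4≤T′ ⟩
    T′         ∎
  step : 48 ℕ.* C ℕ.* (T′ ℕ.* T′) ℕ.+ T ℕ.^ 4 ℕ.≤ T′ ℕ.^ 4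
  step = begin
    48 ℕ.* C ℕ.* (T′ ℕ.* T′) ℕ.+ T ℕ.^ 4
      ≤⟨ ℕ.+-mono-≤ (ℕ.*-monoˡ-≤ (T′ ℕ.* T′) 48C≤T′) (ℕ.≤-trans T^4≤T′ (ℕ.m≤m*n T′ (T′ ℕ.* T′) {{ℕ.>-nonZero (ℕ.*-mono-≤ 1≤T′ 1≤T′)}})) ⟩
    T′ ℕ.* (T′ ℕ.* T′) ℕ.+ T′ ℕ.* (T′ ℕ.* T′)
      ≡⟨ solve 1 (λ t → t :* (t :* t) :+ t :* (t :* t) := t :* (t :* (t :* con 2))) ≡.refl T′ ⟩
    T′ ℕ.* (T′ ℕ.* (T′ ℕ.* 2))
      ≤⟨ ℕ.*-monoʳ-≤ T′ (ℕ.*-monoʳ-≤ T′ (ℕ.*-monoʳ-≤ T′ (ℕ.≤-trans (ℕ.≤-trans (s≤s (s≤s z≤n)) 48≤T′) (ℕ.≤-reflexive (≡.sym (ℕ.*-identityʳ T′)))))) ⟩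
    T′ ℕ.^ 4 ∎

-- Fresh elements

Marking : ℕ → Set
Marking n = Fin n → Bool

everything : ∀ {n} → Marking n
everything _ = true

touches : ∀ {n} → Query n → Fin n → Bool
touches q i = ⌊ i Fin.≟ Query.left q ⌋ ∨ ⌊ i Fin.≟ Query.right q ⌋

degree : ∀ {n k} → Fin n → Vec (Query n) k → ℕ
degree i []       = 0
degree i (q ∷ qs) = (if touches q i then 1 else 0) ℕ.+ degree i qs

unmark : ∀ {n} → Marking n → Query n → Answer → Marking n
unmark U q nothing  i = U i
unmark U q (just _) i = U i ∧ not (touches q i)

-- The elements of U that remain in no unerased comparison after a round.
fresh : ∀ {n k} → Marking n → Vec (Query n) k → Vec Answer k → Marking n
fresh U []       []       = U
fresh U (q ∷ qs) (a ∷ as) = fresh (unmark U q a) qs as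

-- For fixed answers, whether an element survives depends only on which of its own comparisons were
-- erased, so the alternative can be chosen uniformly in `U`. Runs from two different markings can
-- then be compared element by element.
fresh-local : ∀ {n k} (i : Fin n) (qs : Vec (Query n) k) as →
              (∀ U → fresh U qs as i ≡ U i) ⊎ (∀ U → fresh U qs as i ≡ false)
fresh-local i []       []             = inj₁ λ _ → ≡.refl
fresh-local i (q ∷ qs) (nothing ∷ as) with fresh-local i qs as
... | inj₁ same = inj₁ λ U → same (unmark U q nothing)
... | inj₂ gone = inj₂ λ U → gone (unmark U q nothing)
fresh-local i (q ∷ qs) (just b ∷ as) with fresh-local i qs as
... | inj₂ gone = inj₂ λ U → gone (unmark U q (just b))
... | inj₁ same with touches q i in eq
...   | true  = inj₂ λ U → ≡.trans (same (unmark U q (just b)))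
                  (≡.trans (≡.cong (λ t → U i ∧ not t) eq) (Bool.∧-zeroʳ (U i)))
...   | false = inj₁ λ U → ≡.trans (same (unmark U q (just b)))
                  (≡.trans (≡.cong (λ t → U i ∧ not t) eq) (Bool.∧-identityʳ (U i)))

marked? : ∀ {n} (U : Marking n) → Dec (∃[ i ] U i ≡ true)
marked? U = Fin.any? (λ i → U i Bool.≟ true)

-- Reindexing the list of all rankings

allVecs-complete : ∀ n k (v : Vec (Fin n) k) → v ∈ allVecs n k
allVecs-complete n zero    []      = here ≡.refl
allVecs-complete n (suc k) (x ∷ v) = ∈-cartesianProductWith⁺ _∷_ (∈-allFin x) (allVecs-complete n k v)

allVecs-unique : ∀ n k → List.Unique (allVecs n k)
allVecs-unique n zero    = [] ∷ []
allVecs-unique n (suc k) = List.cartesianProductWith⁺ _∷_ Vec.∷-injective (List.allFin⁺ n) (allVecs-unique n k)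

rankings-unique : ∀ n → List.Unique (rankings n)
rankings-unique n = List.filter⁺ unique? (allVecs-unique n n)

∈-rankings⁺ : ∀ {n} {ρ : Ranking n} → Unique ρ → ρ ∈ rankings n
∈-rankings⁺ {n} {ρ} = ∈-filter⁺ unique? (allVecs-complete n n ρ)

∈-rankings⁻ : ∀ {n} {ρ : Ranking n} → ρ ∈ rankings n → Unique ρ
∈-rankings⁻ {n} ρ∈ = proj₂ (∈-filter⁻ unique? {xs = allVecs n n} ρ∈)

-- Since `f` is injective, its image list has no duplicates; since `f` and `g` preserve uniqueness,
-- it has the same members as `rankings n`. Duplicate-free lists with the same members are
-- rearrangements of each other.
rankings-↭ : ∀ {n} (f g : Ranking n → Ranking n) → (∀ ρ → g (f ρ) ≡ ρ) → (∀ ρ → f (g ρ) ≡ ρ) →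
             (∀ {ρ} → Unique ρ → Unique (f ρ)) → (∀ {ρ} → Unique ρ → Unique (g ρ)) →
             List.map f (rankings n) ↭ rankings n
rankings-↭ {n} f g gf fg f-unique g-unique = ∼bag⇒↭ (unique∧set⇒bag
  (List.map⁺ (λ {ρ} {ρ′} eq → ≡.trans (≡.sym (gf ρ)) (≡.trans (≡.cong g eq) (gf ρ′))) (rankings-unique n))
  (rankings-unique n)
  (mk⇔ to from))
  where
  to : ∀ {ρ} → ρ ∈ List.map f (rankings n) → ρ ∈ rankings n
  to ρ∈ with ∈-map⁻ f ρ∈
  ... | ρ₀ , ρ₀∈ , ≡.refl = ∈-rankings⁺ (f-unique (∈-rankings⁻ ρ₀∈))
  from : ∀ {ρ} → ρ ∈ rankings n → ρ ∈ List.map f (rankings n)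
  from {ρ} ρ∈ = ≡.subst (_∈ List.map f (rankings n)) (fg ρ) (∈-map⁺ f (∈-rankings⁺ (g-unique (∈-rankings⁻ ρ∈))))

-- Moving one element to another rank

permutation-injective : ∀ {n} (π : Permutation n n) {x y} → π ⟨$⟩ʳ x ≡ π ⟨$⟩ʳ y → x ≡ y
permutation-injective π eq = ≡.trans (≡.sym (Perm.inverseˡ π)) (≡.trans (≡.cong (π ⟨$⟩ˡ_) eq) (Perm.inverseˡ π))

punchIn-cases : ∀ {n} (i : Fin (suc n)) (j : Fin n) →
                (toℕ j ℕ.< toℕ i × toℕ (punchIn i j) ≡ toℕ j) ⊎ (toℕ i ℕ.≤ toℕ j × toℕ (punchIn i j) ≡ suc (toℕ j))
punchIn-cases zero    j       = inj₂ (z≤n , ≡.refl)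
punchIn-cases (suc i) zero    = inj₁ (s≤s z≤n , ≡.refl)
punchIn-cases (suc i) (suc j) with punchIn-cases i j
... | inj₁ (lt , eq) = inj₁ (s≤s lt , ≡.cong suc eq)
... | inj₂ (le , eq) = inj₂ (s≤s le , ≡.cong suc eq)

-- Every `punchIn i` preserves and reflects the order, so the comparison of two remaining elements
-- does not reveal where the gap is.
punchIn-<? : ∀ {n} (i j : Fin (suc n)) (a b : Fin n) →
             ⌊ punchIn i a Fin.<? punchIn i b ⌋ ≡ ⌊ punchIn j a Fin.<? punchIn j b ⌋
punchIn-<? i j a b with punchIn i a Fin.<? punchIn i b | punchIn j a Fin.<? punchIn j b
... | yes _ | yes _ = ≡.refl
... | no _  | no _  = ≡.refl
... | yes p | no ¬q = contradiction (ℕ.≰⇒> λ le → ℕ.<⇒≱ p (Fin.punchIn-mono-≤ i b a (Fin.punchIn-cancel-≤ j b a le))) ¬q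
... | no ¬p | yes q = contradiction (ℕ.≰⇒> λ le → ℕ.<⇒≱ q (Fin.punchIn-mono-≤ j b a (Fin.punchIn-cancel-≤ i b a le))) ¬p

insert-self : ∀ {n} (i j : Fin (suc n)) (π : Permutation n n) → Perm.insert i j π ⟨$⟩ʳ i ≡ j
insert-self i j π with i Fin.≟ i
... | yes _  = ≡.refl
... | no i≢i = contradiction ≡.refl i≢i

-- Moving the element u from rank k to rank σ k while the others keep their relative order.
module Move {n : ℕ} (σ : Permutation (suc n) (suc n)) (u : Fin (suc n)) where

  relocate : Fin (suc n) → Permutation (suc n) (suc n)
  relocate k = Perm.insert k (σ ⟨$⟩ʳ k) Perm.id

  -- The permutation applied to the ranks depends on the rank of `u`. Therefore `unmove` first
  -- recovers the former rank of `u`, as the preimage under `σ` of the present one.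
  move unmove : Ranking (suc n) → Ranking (suc n)
  move   ρ = Vec.map (relocate (lookup ρ u) ⟨$⟩ʳ_) ρ
  unmove ρ = Vec.map (relocate (σ ⟨$⟩ˡ lookup ρ u) ⟨$⟩ˡ_) ρ

  lookup-move : ∀ ρ x → lookup (move ρ) x ≡ relocate (lookup ρ u) ⟨$⟩ʳ lookup ρ x
  lookup-move ρ x = Vec.lookup-map x _ ρ

  relocate-self : ∀ k → relocate k ⟨$⟩ʳ k ≡ σ ⟨$⟩ʳ k
  relocate-self k = insert-self k (σ ⟨$⟩ʳ k) Perm.id

  relocate-other : ∀ k a → relocate k ⟨$⟩ʳ punchIn k a ≡ punchIn (σ ⟨$⟩ʳ k) a
  relocate-other k a = Perm.insert-punchIn k (σ ⟨$⟩ʳ k) Perm.id a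

  map-inverse : ∀ {f g : Fin (suc n) → Fin (suc n)} → (∀ x → f (g x) ≡ x) → (ρ : Ranking (suc n)) → Vec.map f (Vec.map g ρ) ≡ ρ
  map-inverse {f} {g} fg ρ = ≡.trans (≡.sym (Vec.map-∘ f g ρ)) (≡.trans (Vec.map-cong fg ρ) (Vec.map-id ρ))

  unmove-move : ∀ ρ → unmove (move ρ) ≡ ρ
  unmove-move ρ = ≡.trans (≡.cong (λ k → Vec.map (relocate k ⟨$⟩ˡ_) (move ρ)) source)
                        (map-inverse (λ _ → Perm.inverseˡ (relocate (lookup ρ u))) ρ)
    where
    source : σ ⟨$⟩ˡ lookup (move ρ) u ≡ lookup ρ u
    source = ≡.trans (≡.cong (σ ⟨$⟩ˡ_) (≡.trans (lookup-move ρ u) (relocate-self (lookup ρ u)))) (Perm.inverseˡ σ)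

  move-unmove : ∀ ρ → move (unmove ρ) ≡ ρ
  move-unmove ρ = ≡.trans (≡.cong (λ k → Vec.map (relocate k ⟨$⟩ʳ_) (unmove ρ)) source)
                        (map-inverse (λ _ → Perm.inverseʳ (relocate k₀)) ρ)
    where
    k₀ = σ ⟨$⟩ˡ lookup ρ u
    source : lookup (unmove ρ) u ≡ k₀
    source = permutation-injective (relocate k₀) (≡.trans (≡.cong (relocate k₀ ⟨$⟩ʳ_) (Vec.lookup-map u _ ρ))
      (≡.trans (Perm.inverseʳ (relocate k₀)) (≡.sym (≡.trans (relocate-self k₀) (Perm.inverseʳ σ)))))

  move-unique : ∀ {ρ} → Unique ρ → Unique (move ρ)
  move-unique {ρ} = Unique.map⁺ (permutation-injective (relocate (lookup ρ u)))

  unmove-unique : ∀ {ρ} → Unique ρ → Unique (unmove ρ)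
  unmove-unique {ρ} = Unique.map⁺ (permutation-injective (Perm.flip (relocate (σ ⟨$⟩ˡ lookup ρ u))))

  rankings-move : List.map move (rankings (suc n)) ↭ rankings (suc n)
  rankings-move = rankings-↭ move unmove unmove-move move-unmove move-unique unmove-unique

  module _ {ρ : Ranking (suc n)} (ρ-unique : Unique ρ) where
    private k = lookup ρ u

    other : ∀ {x} → x ≢ u → k ≢ lookup ρ x
    other x≢u eq = x≢u (≡.sym (Unique.lookup-injective ρ-unique _ _ eq))

    -- The rank of `x` among the elements other than `u`, which is invariant under `move`.
    gap : ∀ {x} → x ≢ u → Fin n
    gap x≢u = punchOut (other x≢u)

    lookup-other : ∀ {x} (x≢u : x ≢ u) → lookup ρ x ≡ punchIn k (gap x≢u)
    lookup-other x≢u = ≡.sym (Fin.punchIn-punchOut (other x≢u))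

    lookup-move-other : ∀ {x} (x≢u : x ≢ u) → lookup (move ρ) x ≡ punchIn (σ ⟨$⟩ʳ k) (gap x≢u)
    lookup-move-other {x} x≢u = ≡.trans (lookup-move ρ x) (≡.trans (≡.cong (relocate k ⟨$⟩ʳ_) (lookup-other x≢u)) (relocate-other k (gap x≢u)))

    compare-move : ∀ q → touches q u ≡ false → compare ρ q ≡ compare (move ρ) q
    compare-move (query l r _) untouched with u Fin.≟ l | u Fin.≟ r
    ... | no u≢l | no u≢r
      rewrite lookup-other (u≢l ∘ ≡.sym) | lookup-other (u≢r ∘ ≡.sym)
            | lookup-move-other (u≢l ∘ ≡.sym) | lookup-move-other (u≢r ∘ ≡.sym)
      = punchIn-<? k (σ ⟨$⟩ʳ k) (gap (u≢l ∘ ≡.sym)) (gap (u≢r ∘ ≡.sym))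

-- A permutation of the ranks that changes sides of the median

transpose-cases : ∀ {n} (i j k : Fin n) →
                  (k ≡ i × Perm.transpose i j ⟨$⟩ʳ k ≡ j) ⊎ (k ≡ j × Perm.transpose i j ⟨$⟩ʳ k ≡ i) ⊎ (k ≢ i × k ≢ j × Perm.transpose i j ⟨$⟩ʳ k ≡ k)
transpose-cases i j k with k Fin.≟ i
... | yes k≡i = inj₁ (k≡i , ≡.refl)
... | no k≢i with k Fin.≟ j
...   | yes k≡j = inj₂ (inj₁ (k≡j , ≡.refl))
...   | no k≢j  = inj₂ (inj₂ (k≢i , k≢j , ≡.refl))

-- Reversal alone would fix the median rank for odd n; hence the transposition.
module Halves (p : ℕ) where

  -- The 0-based median rank, as `⌈ 3 ℕ.+ p /2⌉` is 2 + ⌊p/2⌋. It is also half of the top rank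
  -- `2 ℕ.+ p`, rounded down, and it differs from the rank 0 with which it is transposed.
  half : Fin (3 ℕ.+ p)
  half = suc (fromℕ< {⌊ p /2⌋} (s≤s (ℕ.≤-trans (ℕ.⌊n/2⌋≤n p) (ℕ.n≤1+n p))))

  toℕ-half : toℕ half ≡ suc ⌊ p /2⌋
  toℕ-half = ≡.cong suc (Fin.toℕ-fromℕ< _)

  σ : Permutation (3 ℕ.+ p) (3 ℕ.+ p)
  σ = Perm.transpose zero half ∘ₚ Perm.reverse

  opposite-+ : ∀ {n} (i : Fin (suc n)) → toℕ i ℕ.+ toℕ (opposite i) ≡ n
  opposite-+ i = ≡.trans (≡.cong (toℕ i ℕ.+_) (Fin.opposite-prop i)) (ℕ.m+[n∸m]≡n (ℕ.≤-pred (Fin.toℕ<n i)))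

  σ-cases : ∀ k → (k ≡ zero × σ ⟨$⟩ʳ k ≡ opposite half) ⊎ (k ≡ half × σ ⟨$⟩ʳ k ≡ opposite zero) ⊎ (k ≢ half × σ ⟨$⟩ʳ k ≡ opposite k)
  σ-cases k with transpose-cases zero half k
  ... | inj₁ (k≡0 , eq)        = inj₁ (k≡0 , ≡.cong opposite eq)
  ... | inj₂ (inj₁ (k≡h , eq)) = inj₂ (inj₁ (k≡h , ≡.cong opposite eq))
  ... | inj₂ (inj₂ (_ , k≢h , eq)) = inj₂ (inj₂ (k≢h , ≡.cong opposite eq))

  h : ℕ
  h = toℕ half

  1≤h : 1 ℕ.≤ h
  1≤h = s≤s z≤n

  2h≤2+p : h ℕ.+ h ℕ.≤ 2 ℕ.+ p
  2h≤2+p = begin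
    h ℕ.+ h                          ≡⟨ ≡.cong₂ ℕ._+_ toℕ-half toℕ-half ⟩
    suc ⌊ p /2⌋ ℕ.+ suc ⌊ p /2⌋      ≡⟨ ≡.cong suc (ℕ.+-suc ⌊ p /2⌋ ⌊ p /2⌋) ⟩
    2 ℕ.+ (⌊ p /2⌋ ℕ.+ ⌊ p /2⌋)      ≤⟨ ℕ.+-monoʳ-≤ 2 (ℕ.+-monoʳ-≤ ⌊ p /2⌋ (ℕ.⌊n/2⌋≤⌈n/2⌉ p)) ⟩
    2 ℕ.+ (⌊ p /2⌋ ℕ.+ ⌈ p /2⌉)      ≡⟨ ≡.cong (2 ℕ.+_) (ℕ.⌊n/2⌋+⌈n/2⌉≡n p) ⟩
    2 ℕ.+ p                          ∎
    where open ℕ.≤-Reasoning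

  2+p<2[1+h] : 2 ℕ.+ p ℕ.< suc h ℕ.+ suc h
  2+p<2[1+h] = begin-strict
    2 ℕ.+ p                                  ≡⟨ ≡.cong (2 ℕ.+_) (ℕ.⌊n/2⌋+⌈n/2⌉≡n p) ⟨
    2 ℕ.+ (⌊ p /2⌋ ℕ.+ ⌈ p /2⌉)              <⟨ ℕ.+-monoʳ-< 2 (ℕ.+-monoʳ-< ⌊ p /2⌋ (s≤s (ℕ.⌊n/2⌋-mono (ℕ.n≤1+n (suc p))))) ⟩
    2 ℕ.+ (⌊ p /2⌋ ℕ.+ (2 ℕ.+ ⌊ p /2⌋))      ≡⟨ ≡.cong₂ (λ x y → suc x ℕ.+ suc y) toℕ-half toℕ-half ⟨
    suc h ℕ.+ suc h                          ∎
    where open ℕ.≤-Reasoning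

  -- A rank above `h` is not affected by the transposition, and a rank and its opposite add up to
  -- `2 ℕ.+ p`, which is too small for two ranks above `h`.
  not-both-above : ∀ k → h ℕ.< toℕ k → h ℕ.< toℕ (σ ⟨$⟩ʳ k) → ⊥
  not-both-above k h<k h<σk with σ-cases k
  ... | inj₁ (≡.refl , _)        = contradiction h<k λ ()
  ... | inj₂ (inj₁ (≡.refl , _)) = ℕ.<-irrefl ≡.refl h<k
  ... | inj₂ (inj₂ (_ , eq))   = ℕ.<-irrefl (≡.sym (opposite-+ k))
    (ℕ.<-≤-trans 2+p<2[1+h] (ℕ.+-mono-≤ h<k (≡.subst (λ x → h ℕ.< toℕ x) eq h<σk)))

  -- Two opposite ranks below `h` would have too small a sum. The transposed rank 0 goes to the
  -- opposite of `half`, which is at least `h`.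
  not-both-below : ∀ k → toℕ k ℕ.< h → toℕ (σ ⟨$⟩ʳ k) ℕ.< h → ⊥
  not-both-below k k<h σk<h with σ-cases k
  ... | inj₁ (_ , eq)          = ℕ.<-irrefl (opposite-+ half)
    (ℕ.<-≤-trans (ℕ.+-monoʳ-< h (≡.subst (λ x → toℕ x ℕ.< h) eq σk<h)) 2h≤2+p)
  ... | inj₂ (inj₁ (≡.refl , _)) = ℕ.<-irrefl ≡.refl k<h
  ... | inj₂ (inj₂ (_ , eq))   = ℕ.<-irrefl (opposite-+ k)
    (ℕ.<-≤-trans (ℕ.+-mono-< k<h (≡.subst (λ x → toℕ x ℕ.< h) eq σk<h)) 2h≤2+p)

  not-both-at : ∀ k → toℕ k ≡ h → toℕ (σ ⟨$⟩ʳ k) ≡ h → ⊥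
  not-both-at k k≡h σk≡h with σ-cases k
  ... | inj₁ (≡.refl , _)      = contradiction k≡h λ ()
  ... | inj₂ (inj₁ (_ , eq)) = ℕ.<-irrefl (≡.trans (≡.sym σk≡h) (≡.trans (≡.cong toℕ eq) (opposite-+ {2 ℕ.+ p} zero)))
    (ℕ.<-≤-trans (ℕ.m<m+n h 1≤h) 2h≤2+p)
  ... | inj₂ (inj₂ (k≢h , _)) = k≢h (Fin.toℕ-injective k≡h)

  module _ (u : Fin (3 ℕ.+ p)) {ρ : Ranking (3 ℕ.+ p)} (ρ-unique : Unique ρ) where
    open Move σ u

    rank-half : ∀ {ρ x} → IsMedian ρ x → toℕ (lookup ρ x) ≡ h
    rank-half median = ≡.trans (ℕ.suc-injective median) (≡.sym toℕ-half)

    -- If `x` is `u`, then `σ` would fix the median rank. Otherwise `x` can keep rank `h` only if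
    -- `u` stays on the same side of it, that is, stays above `h` or stays below `h`, and `σ`
    -- permits neither.
    not-both-median : ∀ x → IsMedian ρ x → IsMedian (move ρ) x → ⊥
    not-both-median x median median′ with x Fin.≟ u
    ... | yes ≡.refl = not-both-at (lookup ρ x) (rank-half {ρ} {x} median)
      (≡.trans (≡.cong toℕ (≡.sym (≡.trans (lookup-move ρ x) (relocate-self (lookup ρ x))))) (rank-half {move ρ} {x} median′))
    ... | no x≢u = absurd (punchIn-cases (lookup ρ u) (gap ρ-unique x≢u)) (punchIn-cases (σ ⟨$⟩ʳ lookup ρ u) (gap ρ-unique x≢u))
      where
      k j : Fin (3 ℕ.+ p)
      k = lookup ρ u
      j = σ ⟨$⟩ʳ k
      a = gap ρ-unique x≢u
      before : toℕ (punchIn k a) ≡ h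
      before = ≡.trans (≡.cong toℕ (≡.sym (lookup-other ρ-unique x≢u))) (rank-half {ρ} {x} median)
      after : toℕ (punchIn j a) ≡ h
      after = ≡.trans (≡.cong toℕ (≡.sym (lookup-move-other ρ-unique x≢u))) (rank-half {move ρ} {x} median′)
      -- In the two mixed cases `u` changes sides, which shifts the rank of `x` by one although it
      -- should be `h` both times.
      absurd : (toℕ a ℕ.< toℕ k × toℕ (punchIn k a) ≡ toℕ a) ⊎ (toℕ k ℕ.≤ toℕ a × toℕ (punchIn k a) ≡ suc (toℕ a)) →
               (toℕ a ℕ.< toℕ j × toℕ (punchIn j a) ≡ toℕ a) ⊎ (toℕ j ℕ.≤ toℕ a × toℕ (punchIn j a) ≡ suc (toℕ a)) → ⊥
      absurd (inj₁ (a<k , eq)) (inj₁ (a<j , eq′)) = not-both-above k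
        (≡.subst (ℕ._< toℕ k) (≡.trans (≡.sym eq) before) a<k) (≡.subst (ℕ._< toℕ j) (≡.trans (≡.sym eq′) after) a<j)
      absurd (inj₂ (k≤a , eq)) (inj₂ (j≤a , eq′)) = not-both-below k
        (≡.subst (toℕ k ℕ.<_) (≡.trans (≡.sym eq) before) (s≤s k≤a)) (≡.subst (toℕ j ℕ.<_) (≡.trans (≡.sym eq′) after) (s≤s j≤a))
      absurd (inj₁ (_ , eq)) (inj₂ (_ , eq′)) = ℕ.1+n≢n (≡.trans (≡.sym eq′) (≡.trans after (≡.trans (≡.sym before) eq)))
      absurd (inj₂ (_ , eq)) (inj₁ (_ , eq′)) = ℕ.1+n≢n (≡.trans (≡.sym eq) (≡.trans before (≡.trans (≡.sym after) eq′)))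

-- Powers of the erasure probability

module Erasure {c ℓ₁ ℓ₂ : Level} (F : OrderedField c ℓ₁ ℓ₂) where
  open OrderedFieldProperties F
  open ListSum F
  open SemiringExp semiring using (_^_)

  size : ∀ {n} → Marking n → Carrier
  size U = sum (λ i → ind (U i))

  module Channel (γ : Carrier) (0≤γ : 0# ≤ γ) (2γ≤1 : fromℕ 2 * γ ≤ 1#) where

    δ : Carrier
    δ = 1# - γ

    γ≤1 : γ ≤ 1#
    γ≤1 = ≤-by (+-mono-≤ 2γ≤1 0≤γ)
      (solve 1 (λ g → :1 :+ (con (+ 2) :* g :+ con (+ 0)) := g :+ (:1 :+ g)) ≈-refl γ)

    0≤δ : 0# ≤ δ
    0≤δ = ≤⇒0≤- γ≤1

    δ≤1 : δ ≤ 1#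
    δ≤1 = ≤-by′ 0≤γ (solve 1 (λ g → :1 := (:1 :- g) :+ g) ≈-refl γ)

    δ^-nonNeg : ∀ d → 0# ≤ δ ^ d
    δ^-nonNeg zero    = 0≤1
    δ^-nonNeg (suc d) = *-nonNeg 0≤δ (δ^-nonNeg d)

    -- An exponential lower bound on `δ ^ d` without real exponentials. The potential `w` stays
    -- between 3 and 4, and as `w ≤ 4`, one factor `δ` costs at most a decrease of `w` by 4γ. When
    -- `w` falls below 3 it is still at least 1, because γ ≤ 1/2; it is then reset to 4 at the price
    -- of one factor 4, counted by `K`.
    δ^-lower : ∀ d K w → fromℕ 3 ≤ w → w ≤ fromℕ 4 → fromℕ 3 + fromℕ 4 * (fromℕ d * γ) ≤ fromℕ K + w →
               1# ≤ w * δ ^ d * fromℕ (4 ℕ.^ K)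
    δ^-lower zero K w 3≤w _ _ = begin
      1#                           ≈⟨ *-identityˡ 1# ⟨
      1# * 1#                      ≤⟨ *-mono-≤ 0≤1 (fromℕ-nonNeg (4 ℕ.^ K)) 1≤w 1≤4^K ⟩
      w * fromℕ (4 ℕ.^ K)          ≈⟨ *-congʳ (*-identityʳ w) ⟨
      w * 1# * fromℕ (4 ℕ.^ K)     ∎
      where
      open ≤-Reasoning
      1≤w : 1# ≤ w
      1≤w = ≤-trans (≤-trans (≤-reflexive (≈-sym (+-identityʳ 1#))) (fromℕ-mono-≤ {1} {3} (s≤s z≤n))) 3≤w
      1≤4^K : 1# ≤ fromℕ (4 ℕ.^ K)
      1≤4^K = ≤-trans (≤-reflexive (≈-sym (+-identityʳ 1#))) (fromℕ-mono-≤ (ℕ.m^n>0 4 K))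
    δ^-lower (suc d) K w 3≤w w≤4 bound = step K bound (total (fromℕ 3) (w - fromℕ 4 * γ))
      where
      open ≤-Reasoning
      w′ = w - fromℕ 4 * γ
      P  = δ ^ d

      w′≤wδ : w′ ≤ w * δ
      w′≤wδ = ≤-by′ (*-nonNeg 0≤γ (≤⇒0≤- w≤4))
        (solve 2 (λ w g → w :* (:1 :- g) := (w :- con (+ 4) :* g) :+ g :* (con (+ 4) :- w)) ≈-refl w γ)

      w′≤4 : w′ ≤ fromℕ 4
      w′≤4 = ≤-by (+-mono-≤ w≤4 (*-nonNeg (fromℕ-nonNeg 4) 0≤γ))
        (solve 2 (λ w g → con (+ 4) :+ (w :+ con (+ 0)) := (w :- con (+ 4) :* g) :+ (con (+ 4) :+ con (+ 4) :* g)) ≈-refl w γ)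

      1≤w′ : 1# ≤ w′
      1≤w′ = ≤-by (+-mono-≤ 3≤w (*-monoˡ-≤ (fromℕ-nonNeg 2) 2γ≤1))
        (solve 2 (λ w g → (w :- con (+ 4) :* g) :+ (con (+ 3) :+ con (+ 2) :* (con (+ 2) :* g))
                  := :1 :+ (w :+ con (+ 2) :* :1)) ≈-refl w γ)

      remaining : ∀ K → fromℕ 3 + fromℕ 4 * (fromℕ (suc d) * γ) ≤ fromℕ K + w →
                  fromℕ 3 + fromℕ 4 * (fromℕ d * γ) ≤ fromℕ K + w′
      remaining K b = ≤-by b
        (solve 4 (λ k w g d → (k :+ (w :- con (+ 4) :* g)) :+ (con (+ 3) :+ con (+ 4) :* ((:1 :+ d) :* g))
                  := (con (+ 3) :+ con (+ 4) :* (d :* g)) :+ (k :+ w)) ≈-refl (fromℕ K) w γ (fromℕ d))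

      continue : ∀ K → fromℕ 3 + fromℕ 4 * (fromℕ (suc d) * γ) ≤ fromℕ K + w → fromℕ 3 ≤ w′ →
                 1# ≤ w * (δ * P) * fromℕ (4 ℕ.^ K)
      continue K b 3≤w′ = begin
        1#                                ≤⟨ δ^-lower d K w′ 3≤w′ w′≤4 (remaining K b) ⟩
        w′ * P * fromℕ (4 ℕ.^ K)          ≤⟨ *-monoʳ-≤ (fromℕ-nonNeg (4 ℕ.^ K)) (*-monoʳ-≤ (δ^-nonNeg d) w′≤wδ) ⟩
        w * δ * P * fromℕ (4 ℕ.^ K)       ≈⟨ *-congʳ (*-assoc w δ P) ⟩
        w * (δ * P) * fromℕ (4 ℕ.^ K)     ∎

      step : ∀ K → fromℕ 3 + fromℕ 4 * (fromℕ (suc d) * γ) ≤ fromℕ K + w → fromℕ 3 ≤ w′ ⊎ w′ ≤ fromℕ 3 →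
             1# ≤ w * (δ * P) * fromℕ (4 ℕ.^ K)
      step K       b (inj₁ 3≤w′) = continue K b 3≤w′
      -- With no reset left, the hypothesis itself forces `3 ≤ w′`.
      step zero    b (inj₂ _)    = continue zero b (≤-by
        (+-mono-≤ (remaining 0 b) (*-nonNeg (fromℕ-nonNeg 4) (*-nonNeg (fromℕ-nonNeg d) 0≤γ)))
        (solve 2 (λ w x → w :+ ((con (+ 3) :+ x) :+ con (+ 0)) := con (+ 3) :+ ((con (+ 0) :+ w) :+ x))
          ≈-refl w′ (fromℕ 4 * (fromℕ d * γ))))
      step (suc K) b (inj₂ w′≤3) = begin
        1#                                           ≤⟨ δ^-lower d K (fromℕ 4) (fromℕ-mono-≤ (ℕ.n≤1+n 3)) ≤-refl carried ⟩
        fromℕ 4 * P * fromℕ (4 ℕ.^ K)                ≈⟨ solve 2 (λ p x → con (+ 4) :* p :* x := p :* (con (+ 4) :* x)) ≈-refl P (fromℕ (4 ℕ.^ K)) ⟩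
        P * (fromℕ 4 * fromℕ (4 ℕ.^ K))              ≈⟨ *-congˡ (fromℕ-* 4 (4 ℕ.^ K)) ⟨
        P * fromℕ (4 ℕ.^ suc K)                      ≈⟨ *-congʳ (*-identityˡ P) ⟨
        1# * P * fromℕ (4 ℕ.^ suc K)                 ≤⟨ *-monoʳ-≤ (fromℕ-nonNeg (4 ℕ.^ suc K)) (*-monoʳ-≤ (δ^-nonNeg d) (≤-trans 1≤w′ w′≤wδ)) ⟩
        w * δ * P * fromℕ (4 ℕ.^ suc K)              ≈⟨ *-congʳ (*-assoc w δ P) ⟩
        w * (δ * P) * fromℕ (4 ℕ.^ suc K)            ∎
        where
        carried : fromℕ 3 + fromℕ 4 * (fromℕ d * γ) ≤ fromℕ K + fromℕ 4
        carried = ≤-by (+-mono-≤ (remaining (suc K) b) w′≤3)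
          (solve 3 (λ k w x → (k :+ con (+ 4)) :+ ((con (+ 3) :+ x) :+ w)
                    := (con (+ 3) :+ x) :+ (((:1 :+ k) :+ w) :+ con (+ 3))) ≈-refl (fromℕ K) w′ (fromℕ 4 * (fromℕ d * γ)))

    -- Linear in d, so that it can be summed over the elements.
    δ^-linear : ∀ K d → fromℕ K ≤ fromℕ K * (fromℕ (4 ℕ.* 4 ℕ.^ (4 ℕ.* K)) * δ ^ d) + fromℕ d * γ
    -- For a large degree the term `fromℕ d * γ` alone suffices. For a small one `δ^-lower`, started
    -- at potential 4, bounds the power of `δ` below.
    δ^-linear K d with total (fromℕ K) (fromℕ d * γ)
    ... | inj₁ K≤dγ = ≤-by (+-mono-≤ K≤dγ (*-nonNeg (fromℕ-nonNeg K) (*-nonNeg (fromℕ-nonNeg (4 ℕ.* 4 ℕ.^ (4 ℕ.* K))) (δ^-nonNeg d))))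
      (solve 3 (λ k x y → (y :+ x) :+ (k :+ con (+ 0)) := k :+ (x :+ y)) ≈-refl (fromℕ K) _ _)
    ... | inj₂ dγ≤K = begin
      fromℕ K                        ≈⟨ *-identityʳ (fromℕ K) ⟨
      fromℕ K * 1#                   ≤⟨ *-monoˡ-≤ (fromℕ-nonNeg K) 1≤Eδ^d ⟩
      fromℕ K * (fromℕ (4 ℕ.* 4 ℕ.^ (4 ℕ.* K)) * δ ^ d)   ≤⟨ ≤-by′ (*-nonNeg (fromℕ-nonNeg d) 0≤γ) ≈-refl ⟩
      fromℕ K * (fromℕ (4 ℕ.* 4 ℕ.^ (4 ℕ.* K)) * δ ^ d) + fromℕ d * γ   ∎
      where
      open ≤-Reasoning
      scaled : fromℕ 3 + fromℕ 4 * (fromℕ d * γ) ≤ fromℕ (4 ℕ.* K) + fromℕ 4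
      scaled = begin
        fromℕ 3 + fromℕ 4 * (fromℕ d * γ)  ≤⟨ +-mono-≤ (fromℕ-mono-≤ (ℕ.n≤1+n 3)) (*-monoˡ-≤ (fromℕ-nonNeg 4) dγ≤K) ⟩
        fromℕ 4 + fromℕ 4 * fromℕ K        ≈⟨ +-comm _ _ ⟩
        fromℕ 4 * fromℕ K + fromℕ 4        ≈⟨ +-congʳ (fromℕ-* 4 K) ⟨
        fromℕ (4 ℕ.* K) + fromℕ 4          ∎
      1≤Eδ^d : 1# ≤ fromℕ (4 ℕ.* 4 ℕ.^ (4 ℕ.* K)) * δ ^ d
      1≤Eδ^d = begin
        1#                                         ≤⟨ δ^-lower d (4 ℕ.* K) (fromℕ 4) (fromℕ-mono-≤ (ℕ.n≤1+n 3)) ≤-refl scaled ⟩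
        fromℕ 4 * δ ^ d * fromℕ (4 ℕ.^ (4 ℕ.* K))  ≈⟨ solve 3 (λ a b c → a :* b :* c := (a :* c) :* b) ≈-refl (fromℕ 4) (δ ^ d) _ ⟩
        fromℕ 4 * fromℕ (4 ℕ.^ (4 ℕ.* K)) * δ ^ d  ≈⟨ *-congʳ (fromℕ-* 4 (4 ℕ.^ (4 ℕ.* K))) ⟨
        fromℕ (4 ℕ.* 4 ℕ.^ (4 ℕ.* K)) * δ ^ d      ∎

    -- Mean and variance of the number of fresh elements after one round

    E[_,_] : ∀ {n k} → Ranking n → Vec (Query n) k → (Vec Answer k → Carrier) → Carrier
    E[ ρ , qs ] f = expectAnswers F γ ρ qs f

    E-mono : ∀ {n k} (ρ : Ranking n) (qs : Vec (Query n) k) {f g} → (∀ as → f as ≤ g as) → E[ ρ , qs ] f ≤ E[ ρ , qs ] g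
    E-mono ρ []       f≤g = f≤g []
    E-mono ρ (q ∷ qs) f≤g = +-mono-≤ (*-monoˡ-≤ 0≤γ (E-mono ρ qs (λ as → f≤g (_ ∷ as))))
                                     (*-monoˡ-≤ 0≤δ (E-mono ρ qs (λ as → f≤g (_ ∷ as))))

    E-cong : ∀ {n k} (ρ : Ranking n) (qs : Vec (Query n) k) {f g} → (∀ as → f as ≈ g as) → E[ ρ , qs ] f ≈ E[ ρ , qs ] g
    E-cong ρ qs f≈g = antisym (E-mono ρ qs (≤-reflexive ∘ f≈g)) (E-mono ρ qs (≤-reflexive ∘ ≈-sym ∘ f≈g))

    E-const : ∀ {n k} (ρ : Ranking n) (qs : Vec (Query n) k) x → E[ ρ , qs ] (λ _ → x) ≈ x
    E-const ρ []       x = ≈-refl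
    E-const ρ (q ∷ qs) x = ≈-trans (+-cong (*-congˡ (E-const ρ qs x)) (*-congˡ (E-const ρ qs x)))
      (solve 2 (λ g x → g :* x :+ (:1 :- g) :* x := x) ≈-refl γ x)

    E-+ : ∀ {n k} (ρ : Ranking n) (qs : Vec (Query n) k) f g →
          E[ ρ , qs ] (λ as → f as + g as) ≈ E[ ρ , qs ] f + E[ ρ , qs ] g
    E-+ ρ []       f g = ≈-refl
    E-+ ρ (q ∷ qs) f g = ≈-trans (+-cong (*-congˡ (E-+ ρ qs _ _)) (*-congˡ (E-+ ρ qs _ _)))
      (solve 6 (λ g d a b x y → g :* (a :+ b) :+ d :* (x :+ y) := (g :* a :+ d :* x) :+ (g :* b :+ d :* y))
        ≈-refl γ δ _ _ _ _)

    E-* : ∀ {n k} (ρ : Ranking n) (qs : Vec (Query n) k) x f →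
          E[ ρ , qs ] (λ as → x * f as) ≈ x * E[ ρ , qs ] f
    E-* ρ []       x f = ≈-refl
    E-* ρ (q ∷ qs) x f = ≈-trans (+-cong (*-congˡ (E-* ρ qs x _)) (*-congˡ (E-* ρ qs x _)))
      (solve 5 (λ g d x a b → g :* (x :* a) :+ d :* (x :* b) := x :* (g :* a :+ d :* b)) ≈-refl γ δ x _ _)

    sum-touches : ∀ {n} (q : Query n) → sum (λ i → ind (touches q i)) ≤ fromℕ 2
    sum-touches {n} q = begin
      sum (λ i → ind (touches q i))                              ≤⟨ sum-mono-≤ (λ i → ind-∨ ⌊ i Fin.≟ l ⌋ ⌊ i Fin.≟ r ⌋) ⟩
      sum (λ i → ind ⌊ i Fin.≟ l ⌋ + ind ⌊ i Fin.≟ r ⌋)          ≈⟨ ∑-distrib-+ {n} _ _ ⟩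
      sum (λ i → ind ⌊ i Fin.≟ l ⌋) + sum (λ i → ind ⌊ i Fin.≟ r ⌋)   ≈⟨ +-cong (sum-ind-≟ l) (sum-ind-≟ r) ⟩
      1# + 1#                                                    ≈⟨ +-congˡ (+-identityʳ 1#) ⟨
      fromℕ 2                                                    ∎
      where
      open ≤-Reasoning
      l = Query.left q
      r = Query.right q
      ind-∨ : ∀ a b → ind (a ∨ b) ≤ ind a + ind b
      ind-∨ true  b = ≤-by′ (ind-nonNeg b) ≈-refl
      ind-∨ false b = ≤-reflexive (≈-sym (+-identityˡ _))

    sum-degree : ∀ {n k} (qs : Vec (Query n) k) → sum (λ i → fromℕ (degree i qs)) ≤ fromℕ 2 * fromℕ k
    sum-degree {n} []       = ≤-reflexive (≈-trans (sum-replicate-zero n) (≈-sym (zeroʳ _)))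
    sum-degree {n} {suc k} (q ∷ qs) = begin
      sum (λ i → fromℕ (degree i (q ∷ qs)))                                ≈⟨ sum-cong-≋ (λ i → split (touches q i) (degree i qs)) ⟩
      sum (λ i → ind (touches q i) + fromℕ (degree i qs))                  ≈⟨ ∑-distrib-+ {n} _ _ ⟩
      sum (λ i → ind (touches q i)) + sum (λ i → fromℕ (degree i qs))      ≤⟨ +-mono-≤ (sum-touches q) (sum-degree qs) ⟩
      fromℕ 2 + fromℕ 2 * fromℕ k                                          ≈⟨ solve 1 (λ k → con (+ 2) :+ con (+ 2) :* k := con (+ 2) :* (:1 :+ k)) ≈-refl (fromℕ k) ⟩
      fromℕ 2 * fromℕ (suc k)                                              ∎
      where
      open ≤-Reasoning
      split : ∀ t d → fromℕ ((if t then 1 else 0) ℕ.+ d) ≈ ind t + fromℕ d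
      split true  d = ≈-refl
      split false d = ≈-sym (+-identityˡ _)

    -- An element stays fresh exactly when all its comparisons in the batch are erased. These
    -- erasures are independent, also for repeated queries, which `degree` counts with multiplicity.
    E-size : ∀ {n k} (ρ : Ranking n) (qs : Vec (Query n) k) U →
             E[ ρ , qs ] (λ as → size (fresh U qs as)) ≈ sum (λ i → ind (U i) * δ ^ degree i qs)
    E-size {n} ρ []       U = sum-cong-≋ {n} (λ i → ≈-sym (*-identityʳ _))
    E-size {n} ρ (q ∷ qs) U = begin
      γ * E[ ρ , qs ] (λ as → size (fresh U′ qs as)) + δ * E[ ρ , qs ] (λ as → size (fresh U qs as))
        ≈⟨ +-cong (*-congˡ (E-size ρ qs U′)) (*-congˡ (E-size ρ qs U)) ⟩
      γ * sum (λ i → ind (U′ i) * δ ^ degree i qs) + δ * sum (λ i → ind (U i) * δ ^ degree i qs)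
        ≈⟨ +-cong (*-distribˡ-sum {n} γ _) (*-distribˡ-sum {n} δ _) ⟩
      sum (λ i → γ * (ind (U′ i) * δ ^ degree i qs)) + sum (λ i → δ * (ind (U i) * δ ^ degree i qs))
        ≈⟨ ∑-distrib-+ {n} _ _ ⟨
      sum (λ i → γ * (ind (U′ i) * δ ^ degree i qs) + δ * (ind (U i) * δ ^ degree i qs))
        ≈⟨ sum-cong-≋ (λ i → pointwise (U i) (touches q i) (degree i qs)) ⟩
      sum (λ i → ind (U i) * δ ^ degree i (q ∷ qs)) ∎
      where
      open import Relation.Binary.Reasoning.Setoid setoid
      U′ = unmark U q (just (compare ρ q))
      pointwise : ∀ u t d → γ * (ind (u ∧ not t) * δ ^ d) + δ * (ind u * δ ^ d) ≈ ind u * δ ^ ((if t then 1 else 0) ℕ.+ d)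
      pointwise true  true  d = solve 2 (λ g p → g :* (con (+ 0) :* p) :+ (:1 :- g) :* (:1 :* p) := :1 :* ((:1 :- g) :* p)) ≈-refl γ (δ ^ d)
      pointwise true  false d = solve 2 (λ g p → g :* (:1 :* p) :+ (:1 :- g) :* (:1 :* p) := :1 :* p) ≈-refl γ (δ ^ d)
      pointwise false t     d = solve 3 (λ g p x → g :* (con (+ 0) :* p) :+ (:1 :- g) :* (con (+ 0) :* p) := con (+ 0) :* x) ≈-refl γ (δ ^ d) _

    size-unmark-≤ : ∀ {n k} (U : Marking n) q b (qs : Vec (Query n) k) as →
                    size (fresh (unmark U q (just b)) qs as) ≤ size (fresh U qs as)
    size-unmark-≤ U q b qs as = sum-mono-≤ pointwise
      where
      ∧-≤ : ∀ u t → ind (u ∧ t) ≤ ind u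
      ∧-≤ true  t = ind≤1 t
      ∧-≤ false t = ≤-refl
      pointwise : ∀ i → ind (fresh (unmark U q (just b)) qs as i) ≤ ind (fresh U qs as i)
      pointwise i with fresh-local i qs as
      ... | inj₁ same rewrite same U | same (unmark U q (just b)) = ∧-≤ (U i) (not (touches q i))
      ... | inj₂ gone rewrite gone U | gone (unmark U q (just b)) = ≤-refl

    size-≤-unmark : ∀ {n k} (U : Marking n) q b (qs : Vec (Query n) k) as →
                    size (fresh U qs as) ≤ size (fresh (unmark U q (just b)) qs as) + fromℕ 2
    size-≤-unmark {n} U q b qs as = begin
      size (fresh U qs as)                                                      ≤⟨ sum-mono-≤ pointwise ⟩
      sum (λ i → ind (fresh (unmark U q (just b)) qs as i) + ind (touches q i)) ≈⟨ ∑-distrib-+ {n} _ _ ⟩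
      size (fresh (unmark U q (just b)) qs as) + sum (λ i → ind (touches q i))  ≤⟨ +-mono-≤ ≤-refl (sum-touches q) ⟩
      size (fresh (unmark U q (just b)) qs as) + fromℕ 2                        ∎
      where
      open ≤-Reasoning
      ≤-∧ : ∀ u t → ind u ≤ ind (u ∧ not t) + ind t
      ≤-∧ true  true  = ≤-reflexive (≈-sym (+-identityˡ 1#))
      ≤-∧ true  false = ≤-reflexive (≈-sym (+-identityʳ 1#))
      ≤-∧ false t     = ≤-by′ (ind-nonNeg t) (+-congʳ ≈-refl)
      pointwise : ∀ i → ind (fresh U qs as i) ≤ ind (fresh (unmark U q (just b)) qs as i) + ind (touches q i)
      pointwise i with fresh-local i qs as
      ... | inj₁ same rewrite same U | same (unmark U q (just b)) = ≤-∧ (U i) (touches q i)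
      ... | inj₂ gone rewrite gone U | gone (unmark U q (just b)) = ≤-∧ false (touches q i)

    -- Efron–Stein: a single comparison changes the number of fresh elements by at most 2.
    E-deviation : ∀ {n k} (ρ : Ranking n) (qs : Vec (Query n) k) U x →
      let Z = λ as → size (fresh U qs as); μ = E[ ρ , qs ] Z in
      E[ ρ , qs ] (λ as → (Z as - x) * (Z as - x)) ≤ (μ - x) * (μ - x) + fromℕ 4 * (fromℕ k * γ)
    E-deviation ρ []       U x = ≤-by′ (*-nonNeg (fromℕ-nonNeg 4) (≤-reflexive (≈-sym (zeroˡ γ)))) ≈-refl
    E-deviation {k = suc k} ρ (q ∷ qs) U x = begin
      γ * E[ ρ , qs ] (λ as → (Z₁ as - x) * (Z₁ as - x)) + δ * E[ ρ , qs ] (λ as → (Z₀ as - x) * (Z₀ as - x))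
        -- The centre `x` is arbitrary because both branches need the same centre, while their
        -- conditional means `μ₁` and `μ₀` differ.
        ≤⟨ +-mono-≤ (*-monoˡ-≤ 0≤γ (E-deviation ρ qs U′ x)) (*-monoˡ-≤ 0≤δ (E-deviation ρ qs U x)) ⟩
      γ * ((μ₁ - x) * (μ₁ - x) + v) + δ * ((μ₀ - x) * (μ₀ - x) + v)
        -- The variance decomposition for the first answer: a distribution on two values adds
        -- `γ * δ` times the squared gap, which is at most 4γ.
        ≈⟨ solve 5 (λ g a b x v →
             g :* ((a :- x) :* (a :- x) :+ v) :+ (:1 :- g) :* ((b :- x) :* (b :- x) :+ v)
             := ((g :* a :+ (:1 :- g) :* b :- x) :* (g :* a :+ (:1 :- g) :* b :- x) :+ v) :+ g :* ((:1 :- g) :* ((b :- a) :* (b :- a))))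
           ≈-refl γ μ₁ μ₀ x v ⟩
      (μ - x) * (μ - x) + v + γ * (δ * ((μ₀ - μ₁) * (μ₀ - μ₁)))
        ≤⟨ +-mono-≤ ≤-refl (*-monoˡ-≤ 0≤γ (*-mono-≤ 0≤δ (fromℕ-nonNeg 4) δ≤1 gap²≤4)) ⟩
      (μ - x) * (μ - x) + v + γ * (1# * fromℕ 4)
        ≈⟨ solve 3 (λ y k g → y :+ con (+ 4) :* (k :* g) :+ g :* (:1 :* con (+ 4)) := y :+ con (+ 4) :* ((:1 :+ k) :* g))
           ≈-refl ((μ - x) * (μ - x)) (fromℕ k) γ ⟩
      (μ - x) * (μ - x) + fromℕ 4 * (fromℕ (suc k) * γ) ∎
      where
      open ≤-Reasoning
      U′ = unmark U q (just (compare ρ q))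
      Z₁ = λ as → size (fresh U′ qs as)
      Z₀ = λ as → size (fresh U qs as)
      μ₁ = E[ ρ , qs ] Z₁
      μ₀ = E[ ρ , qs ] Z₀
      μ  = γ * μ₁ + δ * μ₀
      v  = fromℕ 4 * (fromℕ k * γ)

      gap-nonNeg : 0# ≤ μ₀ - μ₁
      gap-nonNeg = ≤⇒0≤- (E-mono ρ qs (size-unmark-≤ U q (compare ρ q) qs))

      gap≤2 : μ₀ - μ₁ ≤ fromℕ 2
      gap≤2 = ≤-by
        (≤-trans (E-mono ρ qs (size-≤-unmark U q (compare ρ q) qs))
          (≤-reflexive (≈-trans (E-+ ρ qs Z₁ (λ _ → fromℕ 2)) (+-congˡ (E-const ρ qs (fromℕ 2))))))
        (solve 2 (λ a b → con (+ 2) :+ b := (b :- a) :+ (a :+ con (+ 2))) ≈-refl μ₁ μ₀)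

      gap²≤4 : (μ₀ - μ₁) * (μ₀ - μ₁) ≤ fromℕ 4
      gap²≤4 = ≤-trans (*-mono-≤ gap-nonNeg (fromℕ-nonNeg 2) gap≤2 gap≤2) (≤-reflexive (≈-sym (fromℕ-* 2 2)))

    -- Expectations over a whole run

    -- The function `f` is evaluated at the end of the run, on the elements of `U` that are still
    -- fresh there and on the output. The marking serves only the analysis; the algorithm does not
    -- see it.
    expect : ∀ {n m r} → Algorithm n m r → Ranking n → Marking n → (Marking n → Fin n → Carrier) → Carrier
    expect (output x)          ρ U f = f U x
    expect (round _ qs next) ρ U f = E[ ρ , qs ] (λ as → expect (next as) ρ (fresh U qs as) f)

    expect-mono : ∀ {n m r} (A : Algorithm n m r) ρ U {f g} → (∀ V x → f V x ≤ g V x) → expect A ρ U f ≤ expect A ρ U g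
    expect-mono (output x)        ρ U f≤g = f≤g U x
    expect-mono (round _ qs next) ρ U f≤g = E-mono ρ qs (λ as → expect-mono (next as) ρ (fresh U qs as) f≤g)

    expect-+ : ∀ {n m r} (A : Algorithm n m r) ρ U f g →
               expect A ρ U (λ V x → f V x + g V x) ≈ expect A ρ U f + expect A ρ U g
    expect-+ (output x)        ρ U f g = ≈-refl
    expect-+ (round _ qs next) ρ U f g = ≈-trans (E-cong ρ qs (λ as → expect-+ (next as) ρ (fresh U qs as) f g)) (E-+ ρ qs _ _)

    expect-const : ∀ {n m r} (A : Algorithm n m r) ρ U y → expect A ρ U (λ _ _ → y) ≈ y
    expect-const (output x)        ρ U y = ≈-refl
    expect-const (round _ qs next) ρ U y = ≈-trans (E-cong ρ qs (λ as → expect-const (next as) ρ (fresh U qs as) y)) (E-const ρ qs y)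

    expect-sum : ∀ {n m r} (A : Algorithm n m r) ρ U k (f : Fin k → Marking n → Fin n → Carrier) →
                 expect A ρ U (λ V x → sum (λ i → f i V x)) ≈ sum (λ i → expect A ρ U (f i))
    expect-sum A ρ U zero    f = expect-const A ρ U 0#
    expect-sum A ρ U (suc k) f = ≈-trans (expect-+ A ρ U (f zero) _) (+-congˡ (expect-sum A ρ U k (f ∘ suc)))

    successOn≈expect : ∀ {n m r} (A : Algorithm n m r) ρ U →
                       successOn F γ ρ A ≈ expect A ρ U (λ _ x → ind ⌊ isMedian? ρ x ⌋)
    successOn≈expect (output x)        ρ U = ≈-refl
    successOn≈expect (round _ qs next) ρ U = E-cong ρ qs (λ as → successOn≈expect (next as) ρ (fresh U qs as))

    unmarked : ∀ {n} → Marking n → Carrier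
    unmarked U = ind (not ⌊ marked? U ⌋)

    size-unmarked : ∀ {n} (U : Marking n) → ¬ (∃[ i ] U i ≡ true) → size U ≈ 0#
    size-unmarked {n} U none = ≈-trans (sum-cong-≋ {n} (λ i → ind-false (U i) (λ eq → none (i , eq)))) (sum-replicate-zero n)
      where
      ind-false : ∀ b → b ≢ true → ind b ≈ 0#
      ind-false true  b≢true = contradiction ≡.refl b≢true
      ind-false false _      = ≈-refl

    -- Survival of a fresh element through all rounds

    module _ (C n m : ℕ) (1≤C : 1 ℕ.≤ C) (1≤n : 1 ℕ.≤ n) (mγ≤Cn : fromℕ m * γ ≤ fromℕ C * fromℕ n) where

      -- `δ^-linear` is summed over the marked elements with `K` = 4 C T. The degrees add up to at
      -- most 2 k, so their term is at most half of `K` times the size of `U`, and the other half is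
      -- left for the expected number of survivors.
      E-size-lower : ∀ {k} (ρ : Ranking n) (qs : Vec (Query n) k) U T → k ℕ.≤ m → 1 ℕ.≤ T → fromℕ n ≤ fromℕ T * size U →
                     fromℕ 2 * fromℕ n ≤ fromℕ (4 ℕ.* (shrinkage C T ℕ.* T)) * E[ ρ , qs ] (λ as → size (fresh U qs as))
      E-size-lower {k} ρ qs U T k≤m 1≤T n≤TZ = begin
        fromℕ 2 * fromℕ n                              ≤⟨ *-monoˡ-≤ (fromℕ-nonNeg 2) n≤TZ ⟩
        fromℕ 2 * (fromℕ T * Z)                        ≤⟨ *-monoˡ-≤ (fromℕ-nonNeg 2) (*-monoˡ-≤ (fromℕ-nonNeg T) Z≤2Eμ) ⟩
        fromℕ 2 * (fromℕ T * (fromℕ 2 * (fromℕ E * μ)))  ≈⟨ solve 3 (λ t e u → con (+ 2) :* (t :* (con (+ 2) :* (e :* u))) := con (+ 4) :* (e :* t) :* u) ≈-refl (fromℕ T) (fromℕ E) μ ⟩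
        fromℕ 4 * (fromℕ E * fromℕ T) * μ              ≈⟨ *-congʳ (≈-trans (fromℕ-* 4 (E ℕ.* T)) (*-congˡ (fromℕ-* E T))) ⟨
        fromℕ (4 ℕ.* (E ℕ.* T)) * μ                    ∎
        where
        open ≤-Reasoning
        K = 4 ℕ.* (C ℕ.* T)
        E = shrinkage C T
        Z = size U
        μ = E[ ρ , qs ] (λ as → size (fresh U qs as))
        L = fromℕ C * fromℕ T

        K≈4L : fromℕ K ≈ fromℕ 4 * L
        K≈4L = ≈-trans (fromℕ-* 4 (C ℕ.* T)) (*-congˡ (fromℕ-* C T))

        kγ≤LZ : fromℕ k * γ ≤ L * Z
        kγ≤LZ = begin
          fromℕ k * γ                  ≤⟨ *-monoʳ-≤ 0≤γ (fromℕ-mono-≤ k≤m) ⟩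
          fromℕ m * γ                  ≤⟨ mγ≤Cn ⟩
          fromℕ C * fromℕ n            ≤⟨ *-monoˡ-≤ (fromℕ-nonNeg C) n≤TZ ⟩
          fromℕ C * (fromℕ T * Z)      ≈⟨ *-assoc _ _ _ ⟨
          L * Z                        ∎

        pointwise : ∀ u d → fromℕ K * ind u ≤ fromℕ K * fromℕ E * (ind u * δ ^ d) + γ * fromℕ d
        pointwise true  d = begin
          fromℕ K * 1#                                           ≈⟨ *-identityʳ _ ⟩
          fromℕ K                                                ≤⟨ δ^-linear K d ⟩
          fromℕ K * (fromℕ E * δ ^ d) + fromℕ d * γ              ≈⟨ solve 5 (λ k e p d g → k :* (e :* p) :+ d :* g := k :* e :* (:1 :* p) :+ g :* d) ≈-refl (fromℕ K) (fromℕ E) (δ ^ d) (fromℕ d) γ ⟩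
          fromℕ K * fromℕ E * (1# * δ ^ d) + γ * fromℕ d         ∎
        pointwise false d = ≤-by′ (*-nonNeg 0≤γ (fromℕ-nonNeg d))
          (solve 4 (λ k e p x → k :* e :* (con (+ 0) :* p) :+ x := k :* con (+ 0) :+ x) ≈-refl (fromℕ K) (fromℕ E) (δ ^ d) _)

        KZ≤ : fromℕ K * Z ≤ fromℕ K * fromℕ E * μ + γ * (fromℕ 2 * fromℕ k)
        KZ≤ = begin
          fromℕ K * Z
            ≈⟨ *-distribˡ-sum {n} (fromℕ K) _ ⟩
          sum (λ i → fromℕ K * ind (U i))
            ≤⟨ sum-mono-≤ {n} (λ i → pointwise (U i) (degree i qs)) ⟩
          sum (λ i → fromℕ K * fromℕ E * (ind (U i) * δ ^ degree i qs) + γ * fromℕ (degree i qs))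
            ≈⟨ ∑-distrib-+ {n} _ _ ⟩
          sum (λ i → fromℕ K * fromℕ E * (ind (U i) * δ ^ degree i qs)) + sum (λ i → γ * fromℕ (degree i qs))
            ≈⟨ +-cong (*-distribˡ-sum {n} _ _) (*-distribˡ-sum {n} _ _) ⟨
          fromℕ K * fromℕ E * sum (λ i → ind (U i) * δ ^ degree i qs) + γ * sum (λ i → fromℕ (degree i qs))
            ≤⟨ +-mono-≤ (≤-reflexive (*-congˡ (≈-sym (E-size ρ qs U)))) (*-monoˡ-≤ 0≤γ (sum-degree qs)) ⟩
          fromℕ K * fromℕ E * μ + γ * (fromℕ 2 * fromℕ k) ∎

        4LZ≤ : fromℕ 4 * L * Z ≤ fromℕ 4 * L * fromℕ E * μ + γ * (fromℕ 2 * fromℕ k)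
        4LZ≤ = ≤-trans (≤-reflexive (*-congʳ (≈-sym K≈4L))) (≤-trans KZ≤ (≤-reflexive (+-congʳ (*-congʳ (*-congʳ K≈4L)))))

        2LZ≤ : fromℕ 2 * L * Z ≤ fromℕ 2 * L * (fromℕ 2 * (fromℕ E * μ))
        2LZ≤ = ≤-by (+-mono-≤ 4LZ≤ (*-monoˡ-≤ (fromℕ-nonNeg 2) kγ≤LZ))
          (solve 6 (λ l z e u g k →
              con (+ 2) :* l :* (con (+ 2) :* (e :* u)) :+ (con (+ 4) :* l :* z :+ con (+ 2) :* (k :* g))
              := con (+ 2) :* l :* z :+ ((con (+ 4) :* l :* e :* u :+ g :* (con (+ 2) :* k)) :+ con (+ 2) :* (l :* z)))
            ≈-refl L Z (fromℕ E) μ γ (fromℕ k))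

        2L-positive : Positive (fromℕ 2 * L)
        2L-positive = *-nonNeg (fromℕ-nonNeg 2) (*-nonNeg (fromℕ-nonNeg C) (fromℕ-nonNeg T)) ,
          λ eq → proj₂ (fromℕ-positive (ℕ.*-mono-≤ {1} {2} (s≤s z≤n) (ℕ.*-mono-≤ 1≤C 1≤T)))
                   (≈-trans (≈-trans (fromℕ-* 2 (C ℕ.* T)) (*-congˡ (fromℕ-* C T))) eq)

        Z≤2Eμ : Z ≤ fromℕ 2 * (fromℕ E * μ)
        Z≤2Eμ = *-cancelˡ-≤ 2L-positive 2LZ≤

      -- Induction over the rounds with the invariant `fromℕ n ≤ fromℕ T * size U`, which at a leaf
      -- forces a marked element. A round either preserves it with `exp₃ T` in place of `T`, or
      -- violates it and is charged to the variance. One pointwise inequality covers both cases, so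
      -- that no conditioning on events is needed.
      expect-unmarked : ∀ {r} (A : Algorithm n m r) ρ U T → C ℕ.≤ T → 48 ℕ.≤ T → fromℕ n ≤ fromℕ T * size U →
                        fromℕ n * expect A ρ U (λ V _ → unmarked V) ≤ fromℕ (budget C r T)
      expect-unmarked {r} (output x) ρ U T C≤T 48≤T n≤TZ with marked? U
      ... | yes _   = ≤-trans (≤-reflexive (zeroʳ _)) (fromℕ-nonNeg (budget C r T))
      ... | no none = contradiction
        (antisym (≤-trans n≤TZ (≤-reflexive (≈-trans (*-congˡ (size-unmarked U none)) (zeroʳ _)))) (fromℕ-nonNeg n))
        (proj₂ (fromℕ-positive 1≤n))
      expect-unmarked {suc r} (round {k = k} k≤m qs next) ρ U T C≤T 48≤T n≤TZ = *-cancelˡ-≤ (fromℕ-positive 1≤n) (begin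
        N * (N * E[ ρ , qs ] B)
          ≈⟨ ≈-trans (E-* ρ qs N _) (*-congˡ (E-* ρ qs N B)) ⟨
        E[ ρ , qs ] (λ as → N * (N * B as))
          ≤⟨ E-mono ρ qs pointwise ⟩
        E[ ρ , qs ] (λ as → N * b + t * t * ((Z as - μ) * (Z as - μ)))
          ≈⟨ ≈-trans (E-+ ρ qs _ _) (+-cong (E-const ρ qs (N * b)) (E-* ρ qs (t * t) _)) ⟩
        N * b + t * t * E[ ρ , qs ] (λ as → (Z as - μ) * (Z as - μ))
          ≤⟨ +-mono-≤ ≤-refl (*-monoˡ-≤ (x²-nonNeg t) (E-deviation ρ qs U μ)) ⟩
        N * b + t * t * ((μ - μ) * (μ - μ) + fromℕ 4 * (fromℕ k * γ))
          ≤⟨ +-mono-≤ ≤-refl (*-monoˡ-≤ (x²-nonNeg t) (+-mono-≤ ≤-refl (*-monoˡ-≤ (fromℕ-nonNeg 4) kγ≤Cn))) ⟩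
        N * b + t * t * ((μ - μ) * (μ - μ) + fromℕ 4 * (fromℕ C * N))
          ≈⟨ solve 5 (λ n b t u c → n :* b :+ t :* t :* ((u :- u) :* (u :- u) :+ con (+ 4) :* (c :* n))
                       := n :* (b :+ con (+ 4) :* c :* (t :* t))) ≈-refl N b t μ (fromℕ C) ⟩
        N * (b + fromℕ 4 * fromℕ C * (t * t))
          ≈⟨ *-congˡ (≈-trans (fromℕ-+ (budget C r T′) _) (+-congˡ (≈-trans (fromℕ-* (4 ℕ.* C) (T′ ℕ.* T′)) (*-cong (fromℕ-* 4 C) (fromℕ-* T′ T′))))) ⟨
        N * fromℕ (budget C (suc r) T) ∎)
        where
        open ≤-Reasoning
        T′ = exp₃ T
        N  = fromℕ n
        t  = fromℕ T′
        b  = fromℕ (budget C r T′)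
        Z  = λ as → size (fresh U qs as)
        μ  = E[ ρ , qs ] Z
        B  = λ as → expect (next as) ρ (fresh U qs as) (λ V _ → unmarked V)

        kγ≤Cn : fromℕ k * γ ≤ fromℕ C * N
        kγ≤Cn = ≤-trans (*-monoʳ-≤ 0≤γ (fromℕ-mono-≤ k≤m)) mγ≤Cn

        μ-nonNeg : 0# ≤ μ
        μ-nonNeg = ≤-trans (≤-reflexive (≈-sym (E-const ρ qs 0#)))
          (E-mono ρ qs (λ as → ≤-trans (≤-reflexive (≈-sym (sum-replicate-zero n))) (sum-mono-≤ {n} (λ i → ind-nonNeg (fresh U qs as i)))))

        2N≤tμ : fromℕ 2 * N ≤ t * μ
        2N≤tμ = ≤-trans (E-size-lower ρ qs U T k≤m (ℕ.≤-trans (s≤s z≤n) 48≤T) n≤TZ)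
                        (*-monoʳ-≤ μ-nonNeg (fromℕ-mono-≤ (shrinkage-≤ C≤T 48≤T)))

        B≤1 : ∀ as → B as ≤ 1#
        B≤1 as = ≤-trans (expect-mono (next as) ρ (fresh U qs as) (λ V _ → ind≤1 (not ⌊ marked? V ⌋)))
                         (≤-reflexive (expect-const (next as) ρ (fresh U qs as) 1#))

        -- Chebyshev: if the invariant N ≤ t Z fails then N ≤ t (μ - Z).
        pointwise : ∀ as → N * (N * B as) ≤ N * b + t * t * ((Z as - μ) * (Z as - μ))
        pointwise as with total N (t * Z as)
        ... | inj₁ N≤tZ = ≤-trans
          (*-monoˡ-≤ (fromℕ-nonNeg n) (expect-unmarked (next as) ρ (fresh U qs as) T′
            (ℕ.≤-trans C≤T (T≤exp₃T T)) (ℕ.≤-trans 48≤T (T≤exp₃T T)) N≤tZ))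
          (≤-by′ (*-nonNeg (x²-nonNeg t) (x²-nonNeg (Z as - μ))) ≈-refl)
        ... | inj₂ tZ≤N = begin
          N * (N * B as)       ≤⟨ *-monoˡ-≤ (fromℕ-nonNeg n) (*-monoˡ-≤ (fromℕ-nonNeg n) (B≤1 as)) ⟩
          N * (N * 1#)         ≈⟨ *-congˡ (*-identityʳ N) ⟩
          N * N                ≤⟨ *-mono-≤ (fromℕ-nonNeg n) (≤-trans (fromℕ-nonNeg n) N≤t[μ-Z]) N≤t[μ-Z] N≤t[μ-Z] ⟩
          (t * (μ - Z as)) * (t * (μ - Z as))
            ≈⟨ solve 3 (λ t u z → (t :* (u :- z)) :* (t :* (u :- z)) := con (+ 0) :+ t :* t :* ((z :- u) :* (z :- u))) ≈-refl t μ (Z as) ⟩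
          0# + t * t * ((Z as - μ) * (Z as - μ))
            ≤⟨ +-mono-≤ (*-nonNeg (fromℕ-nonNeg n) (fromℕ-nonNeg (budget C r T′))) ≤-refl ⟩
          N * b + t * t * ((Z as - μ) * (Z as - μ)) ∎
          where
          N≤t[μ-Z] : N ≤ t * (μ - Z as)
          N≤t[μ-Z] = ≤-by (+-mono-≤ 2N≤tμ tZ≤N)
            (solve 4 (λ n t u z → t :* (u :- z) :+ (con (+ 2) :* n :+ t :* z) := n :+ (t :* u :+ n)) ≈-refl N t μ (Z as))

    -- Pairing two orders that differ in the rank of a fresh element

    -- The search `marked?` selects one definite element of a nonempty marking. The event that a
    -- fresh element exists thus splits into disjoint events, one for each `u`, and the pairing can
    -- be done for fixed `u`.
    chosen : ∀ {n} → Fin n → Marking n → Carrier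
    chosen u V with marked? V
    ... | yes (v , _) = ind ⌊ u Fin.≟ v ⌋
    ... | no  _       = 0#

    chosen-nonNeg : ∀ {n} (u : Fin n) V → 0# ≤ chosen u V
    chosen-nonNeg u V with marked? V
    ... | yes (v , _) = ind-nonNeg ⌊ u Fin.≟ v ⌋
    ... | no  _       = ≤-refl

    chosen-false : ∀ {n} (u : Fin n) V → V u ≡ false → chosen u V ≈ 0#
    chosen-false u V Vu≡false with marked? V
    ... | no  _           = ≈-refl
    ... | yes (v , Vv≡true) with u Fin.≟ v
    ...   | yes ≡.refl = contradiction (≡.trans (≡.sym Vu≡false) Vv≡true) λ ()
    ...   | no  _      = ≈-refl

    unmarked+sum-chosen : ∀ {n} (V : Marking n) → unmarked V + sum (λ u → chosen u V) ≈ 1#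
    unmarked+sum-chosen {n} V with marked? V
    ... | yes (v , _) = ≈-trans (+-identityˡ _) (sum-ind-≟ v)
    ... | no  _       = ≈-trans (+-congˡ (sum-replicate-zero n)) (+-identityʳ 1#)

    fresh-false : ∀ {n k} (u : Fin n) U (qs : Vec (Query n) k) as → U u ≡ false → fresh U qs as u ≡ false
    fresh-false u U qs as Uu≡false with fresh-local u qs as
    ... | inj₁ same = ≡.trans (same U) Uu≡false
    ... | inj₂ gone = gone U

    -- An element that is no longer fresh never becomes fresh again, so anything that vanishes
    -- without `u` has expectation zero from then on.
    expect-false : ∀ {n m r} (A : Algorithm n m r) ρ U u f → (∀ V x → V u ≡ false → f V x ≈ 0#) →
                   U u ≡ false → expect A ρ U f ≈ 0#
    expect-false (output x)        ρ U u f f≈0 Uu≡false = f≈0 U x Uu≡false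
    expect-false (round _ qs next) ρ U u f f≈0 Uu≡false = ≈-trans
      (E-cong ρ qs (λ as → expect-false (next as) ρ (fresh U qs as) u f f≈0 (fresh-false u U qs as Uu≡false)))
      (E-const ρ qs 0#)

    median : ∀ {n} → Ranking n → Fin n → Carrier
    median ρ x = ind ⌊ isMedian? ρ x ⌋

    module _ {n : ℕ} (u : Fin n) (ρ ρ′ : Ranking n)
      (same : ∀ q → touches q u ≡ false → compare ρ q ≡ compare ρ′ q)
      (exclusive : ∀ x → ¬ (IsMedian ρ x × IsMedian ρ′ x)) where

      f f′ g : Marking n → Fin n → Carrier
      f  V x = chosen u V * median ρ x
      f′ V x = chosen u V * median ρ′ x
      g  V _ = chosen u V

      median+median≤1 : ∀ x → median ρ x + median ρ′ x ≤ 1#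
      median+median≤1 x with isMedian? ρ x | isMedian? ρ′ x
      ... | yes p | yes p′ = contradiction (p , p′) (exclusive x)
      ... | yes _ | no _   = ≤-reflexive (+-identityʳ 1#)
      ... | no _  | yes _  = ≤-reflexive (+-identityˡ 1#)
      ... | no _  | no _   = ≤-trans (≤-reflexive (+-identityʳ 0#)) 0≤1

      -- While u is fresh the two rankings produce the same answers; once it is
      -- not, all three expectations vanish.
      expect-paired : ∀ {m r} (A : Algorithm n m r) U → expect A ρ U f + expect A ρ′ U f′ ≤ expect A ρ U g
      expect-paired (output x) U = begin
        chosen u U * median ρ x + chosen u U * median ρ′ x  ≈⟨ distribˡ _ _ _ ⟨
        chosen u U * (median ρ x + median ρ′ x)             ≤⟨ *-monoˡ-≤ (chosen-nonNeg u U) (median+median≤1 x) ⟩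
        chosen u U * 1#                                     ≈⟨ *-identityʳ _ ⟩
        chosen u U                                          ∎
        where open ≤-Reasoning
      expect-paired {m} {suc r} (round _ qs next) U = answers qs next (λ as → expect-paired (next as)) U
        where
        -- Inner induction over the queries of the round. The marking changes with each answer, so
        -- the claim is generalised over it and over the remaining batch.
        answers : ∀ {k} (qs : Vec (Query n) k) (next : Vec Answer k → Algorithm n m r) →
                  (∀ as V → expect (next as) ρ V f + expect (next as) ρ′ V f′ ≤ expect (next as) ρ V g) →
                  ∀ U → E[ ρ , qs ] (λ as → expect (next as) ρ (fresh U qs as) f) + E[ ρ′ , qs ] (λ as → expect (next as) ρ′ (fresh U qs as) f′)
                        ≤ E[ ρ , qs ] (λ as → expect (next as) ρ (fresh U qs as) g)
        answers []       next ih U = ih [] U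
        answers (q ∷ qs) next ih U = ≤-trans
          (≤-reflexive (solve 6 (λ y z a b a′ b′ → (y :* a :+ z :* b) :+ (y :* a′ :+ z :* b′) := y :* (a :+ a′) :+ z :* (b :+ b′)) ≈-refl γ δ _ _ _ _))
          (+-mono-≤ (*-monoˡ-≤ 0≤γ (answered (touches q u) ≡.refl)) (*-monoˡ-≤ 0≤δ (answers qs (λ as → next (nothing ∷ as)) (λ as → ih (nothing ∷ as)) U)))
          where
          -- The answer is a parameter separate from the order, since the two orders may disagree on
          -- a comparison that touches `u`.
          run : (Marking n → Fin n → Carrier) → Ranking n → Bool → Carrier
          run l τ b = E[ τ , qs ] (λ as → expect (next (just b ∷ as)) τ (fresh (unmark U q (just b)) qs as) l)

          run-false : touches q u ≡ true → ∀ l τ b → (∀ V x → V u ≡ false → l V x ≈ 0#) → run l τ b ≈ 0#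
          run-false touched l τ b l≈0 = ≈-trans
            (E-cong τ qs (λ as → expect-false (next (just b ∷ as)) τ _ u l l≈0 (fresh-false u _ qs as
              (≡.trans (≡.cong (λ t → U u ∧ not t) touched) (Bool.∧-zeroʳ (U u))))))
            (E-const τ qs 0#)

          answered : ∀ t → touches q u ≡ t → run f ρ (compare ρ q) + run f′ ρ′ (compare ρ′ q) ≤ run g ρ (compare ρ q)
          answered false untouched = ≡.subst (λ b → run f ρ (compare ρ q) + run f′ ρ′ b ≤ run g ρ (compare ρ q)) (same q untouched)
            (answers qs (λ as → next (just (compare ρ q) ∷ as)) (λ as → ih (just (compare ρ q) ∷ as)) (unmark U q (just (compare ρ q))))
          answered true touched = ≤-reflexive (≈-trans
            (+-cong (run-false touched f  ρ  _ (λ V x eq → ≈-trans (*-congʳ (chosen-false u V eq)) (zeroˡ _)))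
                    (run-false touched f′ ρ′ _ (λ V x eq → ≈-trans (*-congʳ (chosen-false u V eq)) (zeroˡ _))))
            (≈-trans (+-identityʳ 0#) (≈-sym (run-false touched g ρ _ (λ V x eq → chosen-false u V eq)))))

    -- Success probability of a deterministic algorithm

    module _ (p : ℕ) {m r : ℕ} (A : Algorithm (3 ℕ.+ p) m r) where
      private n = 3 ℕ.+ p

      -- For a fixed order: `B` is the probability that no fresh element is left, `H u` that `u` is
      -- the chosen fresh element, and `G u` that moreover the output is the median.
      B : Ranking n → Carrier
      B ρ = expect A ρ everything (λ V _ → unmarked V)

      G H : Fin n → Ranking n → Carrier
      G u ρ = expect A ρ everything (λ V x → chosen u V * median ρ x)
      H u ρ = expect A ρ everything (λ V _ → chosen u V)

      success-≤ : ∀ ρ → successOn F γ ρ A ≤ B ρ + sum (λ u → G u ρ)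
      success-≤ ρ = begin
        successOn F γ ρ A
          ≈⟨ successOn≈expect A ρ everything ⟩
        expect A ρ everything (λ _ x → median ρ x)
          ≤⟨ expect-mono A ρ everything leaf ⟩
        expect A ρ everything (λ V x → unmarked V + sum (λ u → chosen u V * median ρ x))
          ≈⟨ expect-+ A ρ everything _ _ ⟩
        B ρ + expect A ρ everything (λ V x → sum (λ u → chosen u V * median ρ x))
          ≈⟨ +-congˡ (expect-sum A ρ everything n (λ u V x → chosen u V * median ρ x)) ⟩
        B ρ + sum (λ u → G u ρ) ∎
        where
        open ≤-Reasoning
        leaf : ∀ V x → median ρ x ≤ unmarked V + sum (λ u → chosen u V * median ρ x)
        leaf V x = begin
          median ρ x                                                     ≈⟨ *-identityˡ _ ⟨
          1# * median ρ x                                                ≈⟨ *-congʳ (unmarked+sum-chosen V) ⟨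
          (unmarked V + sum (λ u → chosen u V)) * median ρ x             ≈⟨ distribʳ _ _ _ ⟩
          unmarked V * median ρ x + sum (λ u → chosen u V) * median ρ x  ≤⟨ +-mono-≤ (*-monoˡ-≤ (ind-nonNeg (not ⌊ marked? V ⌋)) (ind≤1 ⌊ isMedian? ρ x ⌋))
                                                                                      (≤-reflexive (*-distribʳ-sum {n} (median ρ x) (λ u → chosen u V))) ⟩
          unmarked V * 1# + sum (λ u → chosen u V * median ρ x)          ≈⟨ +-congʳ (*-identityʳ _) ⟩
          unmarked V + sum (λ u → chosen u V * median ρ x)               ∎

      sum-H≤1 : ∀ ρ → sum (λ u → H u ρ) ≤ 1#
      sum-H≤1 ρ = begin
        sum (λ u → H u ρ)                                         ≈⟨ expect-sum A ρ everything n (λ u V _ → chosen u V) ⟨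
        expect A ρ everything (λ V _ → sum (λ u → chosen u V))    ≤⟨ expect-mono A ρ everything (λ V _ →
                                                                       ≤-trans (≤-by′ (ind-nonNeg (not ⌊ marked? V ⌋)) (+-comm _ _)) (≤-reflexive (unmarked+sum-chosen V))) ⟩
        expect A ρ everything (λ _ _ → 1#)                        ≈⟨ expect-const A ρ everything 1# ⟩
        1#                                                        ∎
        where open ≤-Reasoning

      open Halves p

      -- Moving `u` permutes the rankings, so it produces a second copy of the sum of `G u`. Paired
      -- with the first copy order by order, it is bounded by `expect-paired`.
      2ΣG≤ΣH : ∀ u → fromℕ 2 * listSum (rankings n) (G u) ≤ listSum (rankings n) (H u)
      2ΣG≤ΣH u = begin
        fromℕ 2 * ΣG                                             ≈⟨ solve 1 (λ x → con (+ 2) :* x := x :+ x) ≈-refl ΣG ⟩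
        ΣG + ΣG                                                  ≈⟨ +-congˡ (listSum-↭ rankings-move (G u)) ⟨
        ΣG + listSum (List.map move (rankings n)) (G u)          ≡⟨ ≡.cong (λ s → ΣG + s) (listSum-map move (rankings n) (G u)) ⟩
        ΣG + listSum (rankings n) (G u ∘ move)                   ≈⟨ listSum-+ (rankings n) (G u) (G u ∘ move) ⟨
        listSum (rankings n) (λ ρ → G u ρ + G u (move ρ))        ≤⟨ listSum-mono (rankings n) paired ⟩
        listSum (rankings n) (H u)                               ∎
        where
        open ≤-Reasoning
        open Move σ u
        ΣG = listSum (rankings n) (G u)
        paired : ∀ {ρ} → ρ ∈ rankings n → G u ρ + G u (move ρ) ≤ H u ρ
        paired {ρ} ρ∈ = expect-paired u ρ (move ρ) (compare-move (∈-rankings⁻ ρ∈))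
          (λ x (med , med′) → not-both-median u (∈-rankings⁻ ρ∈) x med med′) A everything

      -- No fresh element is left with probability at most 1/12, and otherwise a correct output
      -- accounts for at most 1/2 on average. The sum 7/12 is below 2/3.
      12*successes≤ : (∀ ρ → fromℕ 12 * B ρ ≤ 1#) →
        fromℕ 12 * listSum (rankings n) (λ ρ → successOn F γ ρ A) ≤ fromℕ 7 * fromℕ (length (rankings n))
      12*successes≤ 12B≤1 = ≤-by
        (+-mono-≤ (*-monoˡ-≤ (fromℕ-nonNeg 12) S≤ΣB+ΣΣG) (+-mono-≤ 12ΣB≤L (*-monoˡ-≤ (fromℕ-nonNeg 6) 2ΣΣG≤L)))
        (solve 4 (λ s b g l →
            con (+ 7) :* l :+ (con (+ 12) :* s :+ (con (+ 12) :* b :+ con (+ 6) :* (con (+ 2) :* g)))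
            := con (+ 12) :* s :+ (con (+ 12) :* (b :+ g) :+ (l :+ con (+ 6) :* l)))
          ≈-refl S ΣB ΣΣG L)
        where
        open ≤-Reasoning
        R   = rankings n
        L   = fromℕ (length R)
        S   = listSum R (λ ρ → successOn F γ ρ A)
        ΣB  = listSum R B
        ΣΣG = sum (λ u → listSum R (G u))

        S≤ΣB+ΣΣG : S ≤ ΣB + ΣΣG
        S≤ΣB+ΣΣG = begin
          S                                              ≤⟨ listSum-mono R (λ {ρ} _ → success-≤ ρ) ⟩
          listSum R (λ ρ → B ρ + sum (λ u → G u ρ))      ≈⟨ listSum-+ R B _ ⟩
          ΣB + listSum R (λ ρ → sum (λ u → G u ρ))       ≈⟨ +-congˡ (listSum-sum R n G) ⟩
          ΣB + ΣΣG                                       ∎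

        12ΣB≤L : fromℕ 12 * ΣB ≤ L
        12ΣB≤L = begin
          fromℕ 12 * ΣB                    ≈⟨ listSum-* R (fromℕ 12) B ⟨
          listSum R (λ ρ → fromℕ 12 * B ρ) ≤⟨ listSum-mono R (λ {ρ} _ → 12B≤1 ρ) ⟩
          listSum R (λ _ → 1#)             ≈⟨ listSum-1 R ⟩
          L                                ∎

        2ΣΣG≤L : fromℕ 2 * ΣΣG ≤ L
        2ΣΣG≤L = begin
          fromℕ 2 * ΣΣG                             ≈⟨ *-distribˡ-sum {n} (fromℕ 2) (λ u → listSum R (G u)) ⟩
          sum (λ u → fromℕ 2 * listSum R (G u))     ≤⟨ sum-mono-≤ {n} 2ΣG≤ΣH ⟩
          sum (λ u → listSum R (H u))               ≈⟨ listSum-sum R n H ⟨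
          listSum R (λ ρ → sum (λ u → H u ρ))       ≤⟨ listSum-mono R (λ {ρ} _ → sum-H≤1 ρ) ⟩
          listSum R (λ _ → 1#)                      ≈⟨ listSum-1 R ⟩
          L                                         ∎

-- Randomized algorithms and the final constants

module _ {c ℓ₁ ℓ₂ : Level} (F : OrderedField c ℓ₁ ℓ₂) where
  open OrderedFieldProperties F
  open Erasure F
  open ListSum F

  average-≤ : ∀ {a} {A : Set a} (xs : List A) (f : A → Carrier) x y → 0# ≤ y →
              x * listSum xs f ≤ y * fromℕ (length xs) → x * average F xs f ≤ y
  -- The numerator is `0#` here, so the average is zero whatever value `0# ⁻¹` has.
  average-≤ []         f x y 0≤y _  = ≤-trans (≤-reflexive (≈-trans (*-congˡ (zeroˡ _)) (zeroʳ x))) 0≤y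
  average-≤ xs@(_ ∷ _) f x y _   le = *-cancelˡ-≤ L-positive (begin
    L * (x * average F xs f)   ≈⟨ solve 3 (λ l x a → l :* (x :* a) := x :* (a :* l)) ≈-refl L x (average F xs f) ⟩
    x * (average F xs f * L)   ≈⟨ *-congˡ (/-cancelʳ (listSum xs f) (proj₂ L-positive)) ⟩
    x * listSum xs f           ≤⟨ le ⟩
    y * L                      ≈⟨ *-comm y L ⟩
    L * y                      ∎)
    where
    open ≤-Reasoning
    L = fromℕ (length xs)
    L-positive : Positive L
    L-positive = fromℕ-positive {length xs} (s≤s z≤n)

  -- The easy direction of Yao's principle: a bound for every seed passes to the weighted mean.
  mixture-≤ : ∀ {k} (w a : Fin k → Carrier) x y → (∀ i → 0# ≤ w i) → sum w ≈ 1# →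
              (∀ i → x * a i ≤ y) → x * sum (λ i → w i * a i) ≤ y
  mixture-≤ {k} w a x y w-nonNeg w-sum le = begin
    x * sum (λ i → w i * a i)      ≈⟨ *-distribˡ-sum {k} x (λ i → w i * a i) ⟩
    sum (λ i → x * (w i * a i))    ≤⟨ sum-mono-≤ {k} pointwise ⟩
    sum (λ i → w i * y)            ≈⟨ *-distribʳ-sum {k} y w ⟨
    sum w * y                      ≈⟨ *-congʳ w-sum ⟩
    1# * y                         ≈⟨ *-identityˡ y ⟩
    y                              ∎
    where
    open ≤-Reasoning
    pointwise : ∀ i → x * (w i * a i) ≤ w i * y
    pointwise i = ≤-trans (≤-reflexive (solve 3 (λ x w a → x :* (w :* a) := w :* (x :* a)) ≈-refl x (w i) (a i)))
                          (*-monoˡ-≤ (w-nonNeg i) (le i))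

  n≤T*size-everything : ∀ n T → 1 ℕ.≤ T → fromℕ n ≤ fromℕ T * size {n} everything
  n≤T*size-everything n T 1≤T = begin
    fromℕ n                              ≤⟨ fromℕ-mono-≤ (ℕ.m≤n*m n T {{ℕ.>-nonZero 1≤T}}) ⟩
    fromℕ (T ℕ.* n)                      ≈⟨ fromℕ-* T n ⟩
    fromℕ T * fromℕ n                    ≈⟨ *-congˡ (sum-replicate n) ⟨
    fromℕ T * size {n} everything        ∎
    where open ≤-Reasoning

  12*successProbability≤7 : ∀ C T n m r γ → 0# ≤ γ → fromℕ 2 * γ ≤ 1# → fromℕ m * γ ≤ fromℕ C * fromℕ n →
    1 ℕ.≤ C → C ℕ.≤ T → 48 ℕ.≤ T → tower (suc r) T ℕ.≤ n → 3 ℕ.≤ n →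
    (A : RandomizedAlgorithm F n m r) → fromℕ 12 * successProbability F γ A ≤ fromℕ 7
  12*successProbability≤7 C T n@(suc (suc (suc p))) m r γ 0≤γ 2γ≤1 mγ≤Cn 1≤C C≤T 48≤T tower≤n (s≤s (s≤s (s≤s _))) A =
    mixture-≤ weight (λ s → average F (rankings n) (λ ρ → successOn F γ ρ (run s))) (fromℕ 12) (fromℕ 7) weight-nonNeg weight-sum
      (λ s → average-≤ (rankings n) _ (fromℕ 12) (fromℕ 7) (fromℕ-nonNeg 7) (12*successes≤ p (run s) (12B≤1 (run s))))
    where
    open RandomizedAlgorithm A
    open Channel γ 0≤γ 2γ≤1
    open ≤-Reasoning
    12B≤1 : (A : Algorithm n m r) → ∀ ρ → fromℕ 12 * B p A ρ ≤ 1#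
    12B≤1 A ρ = *-cancelˡ-≤ (fromℕ-positive {n} (s≤s z≤n)) (begin
      fromℕ n * (fromℕ 12 * B p A ρ)         ≈⟨ solve 3 (λ n x b → n :* (x :* b) := x :* (n :* b)) ≈-refl (fromℕ n) (fromℕ 12) (B p A ρ) ⟩
      fromℕ 12 * (fromℕ n * B p A ρ)         ≤⟨ *-monoˡ-≤ (fromℕ-nonNeg 12) (expect-unmarked C n m 1≤C (s≤s z≤n) mγ≤Cn A ρ everything T C≤T 48≤T
                                                  (n≤T*size-everything n T (ℕ.≤-trans (s≤s z≤n) 48≤T))) ⟩
      fromℕ 12 * fromℕ (budget C r T)        ≈⟨ fromℕ-* 12 (budget C r T) ⟨
      fromℕ (12 ℕ.* budget C r T)            ≤⟨ fromℕ-mono-≤ (ℕ.≤-trans (ℕ.≤-trans (ℕ.m≤m+n _ (T ℕ.^ 4)) (budget-≤ C r T C≤T 48≤T)) tower≤n) ⟩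
      fromℕ n                                ≈⟨ *-identityʳ _ ⟨
      fromℕ n * 1#                           ∎)

  12*2/3≰7 : ¬ fromℕ 12 * (fromℕ 2 / fromℕ 3) ≤ fromℕ 7
  12*2/3≰7 le = 1+k≰0 0 (≤-by le (begin
    0# + fromℕ 12 * (fromℕ 2 / fromℕ 3)            ≈⟨ solve 1 (λ t → con (+ 0) :+ con (+ 12) :* (con (+ 2) :* t) := con (+ 8) :* (con (+ 3) :* t)) ≈-refl (fromℕ 3 ⁻¹) ⟩
    fromℕ 8 * (fromℕ 3 * fromℕ 3 ⁻¹)               ≈⟨ *-congˡ (⁻¹-inverseʳ (fromℕ 3) (proj₂ (fromℕ-positive {3} (s≤s z≤n)))) ⟩
    fromℕ 8 * 1#                                   ≈⟨ solve 0 (con (+ 8) :* :1 := con (+ 1) :+ con (+ 7)) ≈-refl ⟩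
    fromℕ 1 + fromℕ 7                              ∎))
    where open import Relation.Binary.Reasoning.Setoid setoid

  2γ≤1 : ∀ {γ} → γ ≤ fromℕ 1 / fromℕ 2 → fromℕ 2 * γ ≤ 1#
  2γ≤1 {γ} γ≤1/2 = begin
    fromℕ 2 * γ                      ≤⟨ *-monoˡ-≤ (fromℕ-nonNeg 2) γ≤1/2 ⟩
    fromℕ 2 * (fromℕ 1 / fromℕ 2)    ≈⟨ *-comm _ _ ⟩
    (fromℕ 1 / fromℕ 2) * fromℕ 2    ≈⟨ /-cancelʳ (fromℕ 1) (proj₂ (fromℕ-positive {2} (s≤s z≤n))) ⟩
    fromℕ 1                          ≈⟨ +-identityʳ 1# ⟩
    1#                               ∎
    where open ≤-Reasoning

  -- Passing from `C` to `suc C` makes the constant at least 1 also for `C` = 0, so that it can be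
  -- cancelled in `E-size-lower`.
  mγ≤[1+C]n : ∀ C n m {γ} → Positive γ → fromℕ m ≤ fromℕ C * (fromℕ n / γ) → fromℕ m * γ ≤ fromℕ (suc C) * fromℕ n
  mγ≤[1+C]n C n m {γ} (0≤γ , γ≉0) le = begin
    fromℕ m * γ                        ≤⟨ *-monoʳ-≤ 0≤γ le ⟩
    fromℕ C * (fromℕ n / γ) * γ        ≈⟨ *-assoc _ _ _ ⟩
    fromℕ C * ((fromℕ n / γ) * γ)      ≈⟨ *-congˡ (/-cancelʳ (fromℕ n) γ≉0) ⟩
    fromℕ C * fromℕ n                  ≤⟨ *-monoʳ-≤ (fromℕ-nonNeg n) (fromℕ-mono-≤ (ℕ.n≤1+n C)) ⟩
    fromℕ (suc C) * fromℕ n            ∎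
    where open ≤-Reasoning

-- For r = 0 the hypothesis on log* n says nothing: there the lower bound on n is needed.
tower-≤ : ∀ T r n → tower 1 T ℕ.≤ n → ¬ log* n ℕ.≤ (6 ℕ.+ log* T) ℕ.* r → tower (suc r) T ℕ.≤ n
tower-≤ T zero    n N≤n _    = N≤n
tower-≤ T (suc r) n _   many with ℕ.≤-total (tower (2 ℕ.+ r) T) n
... | inj₁ tower≤n = tower≤n
... | inj₂ n≤tower = contradiction (begin
  log* n                                        ≤⟨ log*-mono n≤tower ⟩
  log* (tower (2 ℕ.+ r) T)                      ≤⟨ log*-tower (2 ℕ.+ r) T ⟩
  (2 ℕ.+ r) ℕ.* 3 ℕ.+ log* T                    ≤⟨ ℕ.m≤m+n _ (r ℕ.* 3 ℕ.+ log* T ℕ.* r) ⟩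
  (2 ℕ.+ r) ℕ.* 3 ℕ.+ log* T ℕ.+ (r ℕ.* 3 ℕ.+ log* T ℕ.* r)
    ≡⟨ solve 2 (λ r l → (con 2 :+ r) :* con 3 :+ l :+ (r :* con 3 :+ l :* r) := (con 6 :+ l) :* (con 1 :+ r)) ≡.refl r (log* T) ⟩
  (6 ℕ.+ log* T) ℕ.* suc r                      ∎) many
  where
  open ℕ.≤-Reasoning
  open +-*-Solver

theorem10 : {c ℓ₁ ℓ₂ : Level} (F : OrderedField c ℓ₁ ℓ₂) →
    let open OrderedField F in
    (C : ℕ) →
    ∃[ d ] ∃[ N ] (∀ (n : ℕ) → N ℕ.≤ n →
    (γ : Carrier) → 0# < γ → γ ≤ fromℕ 1 / fromℕ 2 →
    (m r : ℕ) → fromℕ m ≤ fromℕ C * (fromℕ n / γ) →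
    (A : RandomizedAlgorithm F n m r) →
    fromℕ 2 / fromℕ 3 ≤ successProbability F γ A →
    log* n ℕ.≤ d ℕ.* r)
theorem10 F C = 6 ℕ.+ log* T , tower 1 T , bound
  where
  open OrderedFieldProperties F
  -- The initial threshold has to be at least `suc C` and at least 48. All elements are fresh at the
  -- start, so any positive threshold satisfies the invariant.
  T = suc C ℕ.+ 48
  bound : ∀ n → tower 1 T ℕ.≤ n → ∀ γ → 0# < γ → γ ≤ fromℕ 1 / fromℕ 2 → ∀ m r → fromℕ m ≤ fromℕ C * (fromℕ n / γ) →
          (A : RandomizedAlgorithm F n m r) → fromℕ 2 / fromℕ 3 ≤ successProbability F γ A → log* n ℕ.≤ (6 ℕ.+ log* T) ℕ.* r
  -- The conclusion is decidable, so its negation may be assumed; then `n` exceeds the tower, and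
  -- the success probability is at most 7/12.
  bound n N≤n γ (0≤γ , 0≉γ) γ≤1/2 m r m≤Cn/γ A success with log* n ℕ.≤? (6 ℕ.+ log* T) ℕ.* r
  ... | yes few = few
  ... | no many = contradiction
    (≤-trans (*-monoˡ-≤ (fromℕ-nonNeg 12) success)
      (12*successProbability≤7 F (suc C) T n m r γ 0≤γ (2γ≤1 F γ≤1/2) (mγ≤[1+C]n F C n m (0≤γ , 0≉γ ∘ ≈-sym) m≤Cn/γ)
        (s≤s z≤n) (ℕ.m≤m+n (suc C) 48) 48≤T (tower-≤ T r n N≤n many) 3≤n A))
    (12*2/3≰7 F)
    where
    48≤T : 48 ℕ.≤ T
    48≤T = ℕ.m≤n+m 48 (suc C)
    3≤n : 3 ℕ.≤ n
    3≤n = ℕ.≤-trans (ℕ.≤-trans (ℕ.m≤m+n 3 45) 48≤T) (ℕ.≤-trans (T≤exp₃T T) N≤n)
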